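{- Let $x$ be a variable (or a complex number). For all integers $m\geq 0$ we have $H_{2m}\big(kE_{k-1}(x)\big)=H_{2m}\big(kE_{k-1}\big)=0$, and $$H_{2m+1}\big(kE_{k-1}(x)\big)=(-1)^{m+1}\prod_{\ell=1}^m\ell!^{8},$$ $$H_{2m+1}\big(kE_{k-1}\big)=(-1)^{m+1}2^{4m(m+1)}\prod_{\ell=1}^m\ell!^{8}.$$
   Context: The Euler numbers $E_k$ and Euler polynomials $E_k(x)$ are defined by $\frac{2}{e^t+e^{ -t}}=\sum_{k\ge 0}E_k\frac{t^k}{k!}$ and $\frac{2e^{xt}}{e^t+1}=\sum_{k\ge 0}E_k(x)\frac{t^k}{k!}$. For a sequence $(c_0,c_1,\ldots)$ (always indexed from $k=0$), $H_n(c_k)=\det\big(c_{i+j}\big)_{0\le i,j\le n}$. The $k=0$ terms of the sequences $(kE_{k-1}(x))_{k\ge 0}$ and $(kE_{k-1})_{k\ge0}$ are defined to be $0$. Here $\ell!^8=(\ell!)^8$, and empty products equal $1$. -}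

module Defs where

open import Algebra.Bundles using (CommutativeRing)
open import Algebra.Morphism.Structures using (module RingMorphisms)
import Algebra.Morphism.Construct.Identity as Identity
import Algebra.Properties.Semiring.Exp as SemiringExp
import Algebra.Properties.Semiring.Mult as SemiringMult
import Algebra.Properties.Semiring.Sum as SemiringSum
open import Data.Fin.Base using (Fin; zero; suc; toℕ; punchIn)
open import Data.Integer.Base as ℤ using (+_)
import Data.Integer.Properties as ℤ
open import Data.List.Base using (applyUpTo)
open import Data.Nat.Base as ℕ using (ℕ; zero; suc; _!)
open import Data.Nat.Properties using (_!≢0)
open import Data.Nat.ListAction using (product)
open import Data.Rational.Base as ℚ using (ℚ; ½; 1ℚ; toℚᵘ)
open import Data.Rational.Properties as ℚ using (+-*-commutativeRing; +-*-rawRing)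
open import Data.Rational.Unnormalised.Base as ℚᵘ using (mkℚᵘ; *≡*)
import Data.Rational.Unnormalised.Properties as ℚᵘ
open import Function.Base using (id)
import Level
open import Level using (0ℓ; _⊔_)
open import Relation.Binary.PropositionalEquality using (_≡_; refl; cong)
import Relation.Binary.Reasoning.Setoid as SetoidReasoning

-- Commutative ℚ-algebras.  The polynomial ring ℚ[x] (x a variable) and ℂ
-- (x a complex number) are both instances, so quantifying over a ℚ-algebra and
-- an element x of it covers both readings of x.
record ℚ-Algebra c ℓ : Set (Level.suc (c ⊔ ℓ)) where
  field
    commutativeRing : CommutativeRing c ℓ
  open CommutativeRing commutativeRing public
  open RingMorphisms +-*-rawRing rawRing using (IsRingHomomorphism)
  field
    ι     : ℚ → Carrier
    ι-hom : IsRingHomomorphism ι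

ℚ-algebra : ℚ-Algebra 0ℓ 0ℓ
ℚ-algebra = record
  { commutativeRing = +-*-commutativeRing
  ; ι               = id
  ; ι-hom           = Identity.isRingHomomorphism +-*-rawRing refl
  }

1/_! : ℕ → ℚ
1/ k ! = (+ 1 ℚ./ (k !)) {{k !≢0}}

-- ∏_{ℓ=1}^{m} (ℓ!)^8
∏ℓ!⁸ : ℕ → ℕ
∏ℓ!⁸ m = product (applyUpTo (λ k → (suc k !) ℕ.^ 8) m)

module Over {c ℓ} (A : ℚ-Algebra c ℓ) where

  open ℚ-Algebra A hiding (zero)
  open SemiringExp semiring public using (_^_)
  open SemiringMult semiring public using () renaming (_×_ to _·_)
  open SemiringSum semiring using (sum-syntax; sum⁺-syntax)

  -- Laplace expansion along the first row.
  det : ∀ {n} → (Fin n → Fin n → Carrier) → Carrier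
  det {zero}  M = 1#
  det {suc n} M =
    ∑[ j < suc n ] ((- 1#) ^ toℕ j * M zero j * det (λ i k → M (suc i) (punchIn j k)))

  -- The indices run over 0 ≤ i , j ≤ n, so the matrix has size n + 1.
  H : ℕ → (ℕ → Carrier) → Carrier
  H n c = det {suc n} (λ i j → c (toℕ i ℕ.+ toℕ j))

  -- Formal power series in t: f k is the coefficient of t^k.
  Series : Set c
  Series = ℕ → Carrier

  const : Carrier → Series
  const a zero    = a
  const a (suc k) = 0#

  infixl 6 _⊕_
  infixl 7 _⊛_ _∙_

  _⊕_ : Series → Series → Series
  (f ⊕ g) k = f k + g k

  _⊛_ : Series → Series → Series
  (f ⊛ g) n = ∑[ i ≤ n ] (f (toℕ i) * g (n ℕ.∸ toℕ i))

  _∙_ : Carrier → Series → Series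
  (a ∙ f) k = a * f k

  -- e^{at}
  exp : Carrier → Series
  exp a k = a ^ k * ι (1/ k !)

  -- Long division f / g, where u is an inverse of the constant term of g: the
  -- constant term of the quotient is q₀ = f₀u, and the remaining coefficients are
  -- those of ((f - q₀g)/t) / g.
  quotient : Carrier → Series → Series → Series
  quotient u f g zero    = f 0 * u
  quotient u f g (suc n) = quotient u (λ k → f (suc k) - f 0 * u * g (suc k)) g n

  -- Both denominators below have constant term 2, hence the ι ½.
  eulerNumber : ℕ → Carrier
  eulerNumber k = (k !) · quotient (ι ½) (const (2 · 1#)) (exp 1# ⊕ exp (- 1#)) k

  eulerPolynomial : Carrier → ℕ → Carrier
  eulerPolynomial x k =
    (k !) · quotient (ι ½) ((2 · 1#) ∙ exp x) (exp 1# ⊕ const 1#) k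

  -- The sequence (k c_{k-1})_{k ≥ 0}, with k = 0 term equal to 0.
  shifted : (ℕ → Carrier) → (ℕ → Carrier)
  shifted c zero    = 0#
  shifted c (suc k) = suc k · c k

module Rational = Over ℚ-algebra

-- The defining generating function identities, with denominators cleared.

module _ where

  private
    1+n≃suc-n : ∀ n → ℚᵘ.1ℚᵘ ℚᵘ.+ mkℚᵘ (+ n) 0 ℚᵘ.≃ mkℚᵘ (+ suc n) 0
    1+n≃suc-n n = *≡* (cong (λ z → (+ 1 ℤ.+ z) ℤ.* + 1) (ℤ.*-identityʳ (+ n)))

    toℚᵘ-· : ∀ n p → toℚᵘ (n Rational.· p) ℚᵘ.≃ mkℚᵘ (+ n) 0 ℚᵘ.* toℚᵘ p
    toℚᵘ-· zero    p = ℚᵘ.≃-sym (ℚᵘ.*-zeroˡ (toℚᵘ p))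
    toℚᵘ-· (suc n) p = begin
      toℚᵘ (p ℚ.+ n Rational.· p)                       ≈⟨ ℚ.toℚᵘ-homo-+ p (n Rational.· p) ⟩
      toℚᵘ p ℚᵘ.+ toℚᵘ (n Rational.· p)                 ≈⟨ ℚᵘ.+-congʳ (toℚᵘ p) (toℚᵘ-· n p) ⟩
      toℚᵘ p ℚᵘ.+ mkℚᵘ (+ n) 0 ℚᵘ.* toℚᵘ p              ≈⟨ ℚᵘ.+-congˡ (mkℚᵘ (+ n) 0 ℚᵘ.* toℚᵘ p) (ℚᵘ.*-identityˡ (toℚᵘ p)) ⟨
      ℚᵘ.1ℚᵘ ℚᵘ.* toℚᵘ p ℚᵘ.+ mkℚᵘ (+ n) 0 ℚᵘ.* toℚᵘ p  ≈⟨ ℚᵘ.*-distribʳ-+ (toℚᵘ p) ℚᵘ.1ℚᵘ (mkℚᵘ (+ n) 0) ⟨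
      (ℚᵘ.1ℚᵘ ℚᵘ.+ mkℚᵘ (+ n) 0) ℚᵘ.* toℚᵘ p            ≈⟨ ℚᵘ.*-congʳ {toℚᵘ p} {ℚᵘ.1ℚᵘ ℚᵘ.+ mkℚᵘ (+ n) 0} {mkℚᵘ (+ suc n) 0} (1+n≃suc-n n) ⟩
      mkℚᵘ (+ suc n) 0 ℚᵘ.* toℚᵘ p                      ∎
      where
        open SetoidReasoning ℚᵘ.≃-setoid

  n·1/n≡1 : ∀ n .{{_ : ℕ.NonZero n}} → n Rational.· (+ 1 ℚ./ n) ≡ 1ℚ
  n·1/n≡1 (suc n) = ℚ.toℚᵘ-injective (begin
      toℚᵘ (suc n Rational.· (+ 1 ℚ./ suc n))     ≈⟨ toℚᵘ-· (suc n) (+ 1 ℚ./ suc n) ⟩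
      mkℚᵘ (+ suc n) 0 ℚᵘ.* toℚᵘ (+ 1 ℚ./ suc n)  ≈⟨ ℚᵘ.*-congˡ {mkℚᵘ (+ suc n) 0} (ℚ.toℚᵘ-fromℚᵘ (mkℚᵘ (+ 1) n)) ⟩
      mkℚᵘ (+ suc n) 0 ℚᵘ.* mkℚᵘ (+ 1) n          ≈⟨ ℚᵘ.*-inverseʳ (mkℚᵘ (+ suc n) 0) ⟩
      ℚᵘ.1ℚᵘ                                      ∎)
    where open SetoidReasoning ℚᵘ.≃-setoid

module GeneratingFunctions {c ℓ} (A : ℚ-Algebra c ℓ) where

  open ℚ-Algebra A hiding (zero) renaming (refl to ≈-refl)
  open Over A
  open RingMorphisms +-*-rawRing rawRing using (module IsRingHomomorphism)
  open IsRingHomomorphism ι-hom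
  open SemiringMult semiring using (×-assoc-*; ×-comm-*)
  open SemiringSum semiring using (sum-cong-≋)
  open SetoidReasoning setoid
  private
    ι-· : ∀ n p → ι (n Rational.· p) ≈ n · ι p
    ι-· zero    p = 0#-homo
    ι-· (suc n) p = trans (+-homo p (n Rational.· p)) (+-congˡ (ι-· n p))

    scale : ∀ k a → (k !) · a * ι (1/ k !) ≈ a
    scale k a = begin
      (k !) · a * ι (1/ k !)             ≈⟨ ×-assoc-* (k !) a _ ⟩
      (k !) · (a * ι (1/ k !))           ≈⟨ ×-comm-* (k !) a _ ⟨
      a * (k !) · ι (1/ k !)             ≈⟨ *-congˡ (ι-· (k !) (1/ k !)) ⟨
      a * ι ((k !) Rational.· (1/ k !))  ≈⟨ *-congˡ (⟦⟧-cong (n·1/n≡1 (k !) {{k !≢0}})) ⟩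
      a * ι 1ℚ                           ≈⟨ *-congˡ 1#-homo ⟩
      a * 1#                             ≈⟨ *-identityʳ a ⟩
      a                                  ∎

    exp₀ : ∀ a → exp a 0 ≈ 1#
    exp₀ a = trans (*-identityˡ _) 1#-homo

    ½·2 : ∀ {a b} → a ≈ 1# → b ≈ 1# → ι ½ * (a + b) ≈ 1#
    ½·2 {a} {b} a≈1 b≈1 = begin
      ι ½ * (a + b)        ≈⟨ *-congˡ (+-cong a≈1 b≈1) ⟩
      ι ½ * (1# + 1#)      ≈⟨ distribˡ (ι ½) 1# 1# ⟩
      ι ½ * 1# + ι ½ * 1#  ≈⟨ +-cong (*-identityʳ _) (*-identityʳ _) ⟩
      ι ½ + ι ½            ≈⟨ +-homo ½ ½ ⟨
      ι 1ℚ                 ≈⟨ 1#-homo ⟩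
      1#                   ∎

  quotient-⊛ : ∀ u f g → u * g 0 ≈ 1# → ∀ n → (quotient u f g ⊛ g) n ≈ f n
  quotient-⊛ u f g ug₀≈1 zero = begin
    f 0 * u * g 0 + 0#  ≈⟨ +-identityʳ _ ⟩
    f 0 * u * g 0       ≈⟨ *-assoc (f 0) u (g 0) ⟩
    f 0 * (u * g 0)     ≈⟨ *-congˡ ug₀≈1 ⟩
    f 0 * 1#            ≈⟨ *-identityʳ (f 0) ⟩
    f 0                 ∎
  quotient-⊛ u f g ug₀≈1 (suc n) = begin
    q₀g + (quotient u f′ g ⊛ g) n  ≈⟨ +-congˡ (quotient-⊛ u f′ g ug₀≈1 n) ⟩
    q₀g + (f (suc n) - q₀g)        ≈⟨ +-comm _ _ ⟩
    f (suc n) - q₀g + q₀g          ≈⟨ +-assoc _ _ _ ⟩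
    f (suc n) + (- q₀g + q₀g)      ≈⟨ +-congˡ (-‿inverseˡ q₀g) ⟩
    f (suc n) + 0#                 ≈⟨ +-identityʳ _ ⟩
    f (suc n)                      ∎
    where
      q₀g = f 0 * u * g (suc n)
      f′ : Series
      f′ k = f (suc k) - f 0 * u * g (suc k)

  private
    gf : ∀ f g → ι ½ * g 0 ≈ 1# → ∀ n →
         ((λ k → (k !) · quotient (ι ½) f g k * ι (1/ k !)) ⊛ g) n ≈ f n
    gf f g h n = trans
      (sum-cong-≋
        {x = λ i → (toℕ i !) · q (toℕ i) * ι (1/ toℕ i !) * g (n ℕ.∸ toℕ i)}
        {y = λ i → q (toℕ i) * g (n ℕ.∸ toℕ i)}
        (λ (i : Fin (suc n)) → *-congʳ (scale (toℕ i) (q (toℕ i)))))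
      (quotient-⊛ (ι ½) f g h n)
      where q = quotient (ι ½) f g

  eulerNumber-gf : ∀ n →
    ((λ k → eulerNumber k * ι (1/ k !)) ⊛ (exp 1# ⊕ exp (- 1#))) n ≈ const (2 · 1#) n
  eulerNumber-gf = gf _ _ (½·2 (exp₀ 1#) (exp₀ (- 1#)))

  eulerPolynomial-gf : ∀ x n →
    ((λ k → eulerPolynomial x k * ι (1/ k !)) ⊛ (exp 1# ⊕ const 1#)) n ≈
    ((2 · 1#) ∙ exp x) n
  eulerPolynomial-gf x = gf _ _ (½·2 (exp₀ 1#) ≈-refl)

{-# OPTIONS --safe #-}

-- Let L be the linear functional on polynomials in w with L(w^k) = c_k.  For both
-- sequences there are b, d and x with L(f(w + b) + f(w + b + d)) = 2 f′(x): b = 0, d = 1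
-- for k E_{k-1}(x), and b = -1, d = 2, x = 0 for k E_{k-1}.  Put z = w + b - x and
-- θ_k = ∏_{j = -k}^{k-1} (z - j d).  Applying the relation to ∏_{|j| ≤ k} (w - x - j d),
-- and to its product with w - x, gives L(θ_k) = 0 and L(z θ_k) = V_k := (-1)^k d^{2k} k!².
-- As θ_k is a polynomial in z (z + d), it follows that L(θ_l θ_k) = 0 and
-- L(z θ_l θ_k) = V_k V_l C(k + l, k).  Up to scaling this is the Pascal matrix, and taking
-- differences produces monic t_n of degree 2n with L(θ_l t_n) = 0 for all l,
-- L(z θ_l t_n) = 0 for l < n and L(z θ_n t_n) = V_n².  Column operations replace the columns
-- L(w^i w^j) of the Hankel matrix by L(w^i t_n), L(w^i z t_n); the result is block lower
-- triangular, with diagonal blocks [[0, V_n²], [V_n², ∗]].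

module Submission where

open import Defs
open import Algebra.Morphism.Structures using (module RingMorphisms)
import Algebra.Properties.CommutativeMonoid.Mult as CommutativeMonoidMult
import Algebra.Properties.CommutativeSemiring.Exp as Exp
import Algebra.Properties.Ring as RingProperties
import Algebra.Properties.Semiring.Mult as SemiringMult
import Algebra.Properties.Semiring.Sum as SemiringSum
import Algebra.Solver.Ring as RingSolver
open import Algebra.Solver.Ring.AlmostCommutativeRing 
  using (fromCommutativeRing; Induced-equivalence; _-Raw-AlmostCommutative⟶_)
open import Data.Empty using (⊥-elim)
open import Data.Fin.Base as Fin using (Fin; zero; suc; toℕ; punchIn; punchOut; fromℕ<)
import Data.Fin.Properties as Fin
open import Data.List.Base using ([]; _∷_; _++_; applyUpTo)
open import Data.List.Properties using (applyUpTo-∷ʳ)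
import Data.Maybe.Base as Maybe
open import Data.Nat.Base as ℕ using (ℕ; zero; suc; s≤s; z≤n; _!)
open import Data.Nat.Combinatorics
  using (_C_; nCk+nC[k+1]≡[n+1]C[k+1]; nCk≡nC[n∸k]; nCn≡1; k>n⇒nCk≡0)
open import Data.Nat.ListAction using (product)
open import Data.Nat.ListAction.Properties using (product-++)
import Data.Nat.Properties as ℕ
import Data.Nat.Tactic.RingSolver as ℕ-Solver
open import Data.Product.Base using (∃; _×_; _,_; proj₁; proj₂)
open import Data.Rational.Base as ℚ using (0ℚ; 1ℚ; ½)
import Data.Rational.Properties as ℚ
open import Data.Sum.Base using (_⊎_; inj₁; inj₂)
open import Function.Base using (_∘_; case_of_)
open import Level using (_⊔_)
open import Relation.Binary.Definitions using (WeaklyDecidable; tri<; tri≈; tri>)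
open import Relation.Binary.PropositionalEquality as ≡ using (_≡_; _≢_)
import Relation.Binary.Reasoning.Setoid as SetoidReasoning
open import Relation.Nullary.Decidable using (yes; no; dec⇒maybe)

-- Adjacent column indices under deletion of a column.

-- No index lies strictly between `p` and `q`, so deleting a third one keeps them adjacent.
punchOut-adjacent : ∀ {n} {j p q : Fin (suc n)} (j≢p : j ≢ p) (j≢q : j ≢ q) →
                    toℕ q ≡ suc (toℕ p) → toℕ (punchOut j≢q) ≡ suc (toℕ (punchOut j≢p))
punchOut-adjacent {_}     {zero}        {zero}  {_}        j≢p _ _ = ⊥-elim (j≢p ≡.refl)
punchOut-adjacent {_}     {zero}        {suc p} {suc q}    _ _ eq = ℕ.suc-injective eq
punchOut-adjacent {suc _} {suc zero}    {zero}  {suc zero} _ j≢q _ = ⊥-elim (j≢q ≡.refl)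
punchOut-adjacent {suc (suc _)} {suc (suc j)} {zero}  {suc zero} _ _ _ = ≡.refl
punchOut-adjacent {suc _} {suc j}       {suc p} {suc q}    j≢p j≢q eq =
  ≡.cong suc (punchOut-adjacent (j≢p ∘ ≡.cong suc) (j≢q ∘ ≡.cong suc) (ℕ.suc-injective eq))

-- Deleting `p` and deleting `q` leave the same list of indices, except for one slot that holds `q`
-- in the first case and `p` in the second. Minors at two equal adjacent columns therefore coincide.
punchIn-adjacent : ∀ {n} {p q : Fin (suc n)} → toℕ q ≡ suc (toℕ p) → ∀ k →
  punchIn p k ≡ punchIn q k ⊎ (punchIn p k ≡ q × punchIn q k ≡ p)
punchIn-adjacent {_}     {zero}  {suc zero} eq zero    = inj₂ (≡.refl , ≡.refl)
punchIn-adjacent {_}     {zero}  {suc zero} eq (suc k) = inj₁ ≡.refl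
punchIn-adjacent {_}     {suc p} {suc q}    eq zero    = inj₁ ≡.refl
punchIn-adjacent {suc n} {suc p} {suc q}    eq (suc k)
  with punchIn-adjacent {n} {p} {q} (ℕ.suc-injective eq) k
... | inj₁ e        = inj₁ (≡.cong suc e)
... | inj₂ (e , e′) = inj₂ (≡.cong suc e , ≡.cong suc e′)

-- The ring solver with rational coefficients.

module Solver {c ℓ} (A : ℚ-Algebra c ℓ) where
  open ℚ-Algebra A
  open RingMorphisms ℚ.+-*-rawRing rawRing using (module IsRingHomomorphism)
  open IsRingHomomorphism ι-hom

  -- Coefficients in ℚ have decidable equality and admit constants such as `½`.
  ι-morphism : ℚ.+-*-rawRing -Raw-AlmostCommutative⟶ fromCommutativeRing commutativeRing
  ι-morphism = record
    { ⟦_⟧    = ι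
    ; +-homo = +-homo
    ; *-homo = *-homo
    ; -‿homo = -‿homo
    ; 0-homo = 0#-homo
    ; 1-homo = 1#-homo
    }

  coefficients≟ : WeaklyDecidable (Induced-equivalence ι-morphism)
  coefficients≟ p q = Maybe.map ⟦⟧-cong (dec⇒maybe (p ℚ.≟ q))

  open RingSolver ℚ.+-*-rawRing (fromCommutativeRing commutativeRing) ι-morphism coefficients≟ public

-- Determinants under column operations.

module Determinants {c ℓ} (A : ℚ-Algebra c ℓ) where
  open ℚ-Algebra A hiding (zero)
  open Over A
  open Solver A using (solve; _:=_; _:+_; _:*_; _:-_; :-_; con)
  open RingProperties ring using (-1*x≈-x)
  open SemiringSum semiring using (sum; sum-cong-≋; ∑-distrib-+; *-distribˡ-sum; sum-remove;
    sum-replicate-zero)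
  open SetoidReasoning setoid

  Matrix : ℕ → Set c
  Matrix n = Fin n → Fin n → Carrier

  minor : ∀ {n} → Matrix (suc n) → Fin (suc n) → Matrix n
  minor M j i k = M (suc i) (punchIn j k)

  term : ∀ {n} → Matrix (suc n) → Fin (suc n) → Carrier
  term M j = (- 1#) ^ toℕ j * M zero j * det (minor M j)

  sum≈0 : ∀ {n} {f : Fin n → Carrier} → (∀ i → f i ≈ 0#) → sum f ≈ 0#
  sum≈0 {n} f≈0 = trans (sum-cong-≋ f≈0) (sum-replicate-zero n)

  sum-single : ∀ {n} (f : Fin n → Carrier) (p : Fin n) → (∀ i → p ≢ i → f i ≈ 0#) → sum f ≈ f p
  sum-single {suc n} f p f≈0 = trans (sum-remove {i = p} f)
    (trans (+-congˡ (sum≈0 (λ i → f≈0 (punchIn p i) (Fin.punchInᵢ≢i p i ∘ ≡.sym)))) (+-identityʳ _))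

  sum-pair : ∀ {n} (f : Fin n → Carrier) {p q : Fin n} → p ≢ q →
             (∀ i → p ≢ i → q ≢ i → f i ≈ 0#) → sum f ≈ f p + f q
  sum-pair {suc n} f {p} {q} p≢q f≈0 = trans (sum-remove {i = p} f) (+-congˡ (begin
    sum (f ∘ punchIn p)            ≈⟨ sum-single (f ∘ punchIn p) (punchOut p≢q) (λ i i≢ →
                                      f≈0 (punchIn p i) (Fin.punchInᵢ≢i p i ∘ ≡.sym)
                                        (λ q≡ → i≢ (Fin.punchIn-injective p _ _
                                          (≡.trans (Fin.punchIn-punchOut p≢q) q≡)))) ⟩
    f (punchIn p (punchOut p≢q))   ≡⟨ ≡.cong f (Fin.punchIn-punchOut p≢q) ⟩
    f q                            ∎))

  det-cong : ∀ {n} {M N : Matrix n} → (∀ i j → M i j ≈ N i j) → det M ≈ det N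
  det-cong {zero}  M≈N = refl
  det-cong {suc n} M≈N = sum-cong-≋ {n = suc n} (λ j →
    *-cong (*-congˡ {x = (- 1#) ^ toℕ j} (M≈N zero j)) (det-cong (λ i k → M≈N (suc i) (punchIn j k))))

  -- In the expansion along the first row, the term at `q` is linear through its entry, since its
  -- minor omits column `q`; every other term is linear through its minor, by induction.
  det-linear-column : ∀ {n} (q : Fin n) (s : Carrier) {L M N : Matrix n} →
    (∀ i → N i q ≈ L i q + s * M i q) →
    (∀ i j → q ≢ j → N i j ≈ L i j × N i j ≈ M i j) →
    det N ≈ det L + s * det M
  det-linear-column {suc n} q s {L} {M} {N} at off = begin
    sum (term N)                             ≈⟨ sum-cong-≋ terms ⟩
    sum (λ j → term L j + s * term M j)      ≈⟨ ∑-distrib-+ (term L) (λ j → s * term M j) ⟩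
    det L + sum (λ j → s * term M j)         ≈⟨ +-congˡ (*-distribˡ-sum s (term M)) ⟨
    det L + s * det M                        ∎
    where
    terms : ∀ j → term N j ≈ term L j + s * term M j
    terms j with q Fin.≟ j
    ... | yes ≡.refl = begin
      ε * N zero q * D                           ≈⟨ *-congʳ (*-congˡ (at zero)) ⟩
      ε * (L zero q + s * M zero q) * D
        ≈⟨ solve 5 (λ e l t m d → e :* (l :+ t :* m) :* d := e :* l :* d :+ t :* (e :* m :* d))
             refl ε (L zero q) s (M zero q) D ⟩
      ε * L zero q * D + s * (ε * M zero q * D)  ≈⟨ +-cong
        (*-congˡ (det-cong (λ i k → proj₁ (off (suc i) _ (off-q k)))))
        (*-congˡ (*-congˡ (det-cong (λ i k → proj₂ (off (suc i) _ (off-q k)))))) ⟩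
      term L q + s * term M q ∎
      where
      ε = (- 1#) ^ toℕ q
      D = det (minor N q)
      off-q : ∀ k → q ≢ punchIn q k
      off-q k = Fin.punchInᵢ≢i q k ∘ ≡.sym
    ... | no q≢j = begin
      ε * N zero j * det (minor N j)                                ≈⟨ *-congˡ minors ⟩
      ε * N zero j * (det (minor L j) + s * det (minor M j))
        ≈⟨ solve 5 (λ e x l t m → e :* x :* (l :+ t :* m) := e :* x :* l :+ t :* (e :* x :* m))
             refl ε (N zero j) _ s _ ⟩
      ε * N zero j * det (minor L j) + s * (ε * N zero j * det (minor M j)) ≈⟨ +-cong
        (*-congʳ (*-congˡ (proj₁ (off zero j q≢j))))
        (*-congˡ (*-congʳ (*-congˡ (proj₂ (off zero j q≢j))))) ⟩
      term L j + s * term M j ∎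
      where
      ε = (- 1#) ^ toℕ j
      j≢q : j ≢ q
      j≢q = q≢j ∘ ≡.sym
      minors : det (minor N j) ≈ det (minor L j) + s * det (minor M j)
      minors = det-linear-column (punchOut j≢q) s
        (λ i → ≡.subst (λ k → N (suc i) k ≈ L (suc i) k + s * M (suc i) k)
                 (≡.sym (Fin.punchIn-punchOut j≢q)) (at (suc i)))
        (λ i k q≢k → off (suc i) (punchIn j k) (λ q≡ →
          q≢k (Fin.punchIn-injective j _ _ (≡.trans (Fin.punchIn-punchOut j≢q) q≡))))

  -- The terms at `p` and `q` have equal entries, equal minors and opposite signs, so they cancel.
  -- Every other minor still contains the two equal columns, still adjacent, and vanishes by
  -- induction.
  det-adjacent-equal : ∀ {n} {p q : Fin n} → toℕ q ≡ suc (toℕ p) → {M : Matrix n} →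
                       (∀ i → M i p ≈ M i q) → det M ≈ 0#
  det-adjacent-equal {suc n} {p} {q} adj {M} eq = begin
    sum (term M)                  ≈⟨ sum-pair (term M) p≢q others ⟩
    term M p + term M q
      ≈⟨ +-congˡ (*-cong (*-cong (reflexive (≡.cong ((- 1#) ^_) adj)) (sym (eq zero))) (sym minors)) ⟩
    ε * x * D + - 1# * ε * x * D  ≈⟨ +-congˡ (*-congʳ (*-congʳ (-1*x≈-x ε))) ⟩
    ε * x * D + (- ε) * x * D
      ≈⟨ solve 3 (λ e y d → e :* y :* d :+ (:- e) :* y :* d := con 0ℚ) refl ε x D ⟩
    ι 0ℚ                          ≈⟨ 0#-homo ⟩
    0#                            ∎
    where
    open RingMorphisms ℚ.+-*-rawRing rawRing using (module IsRingHomomorphism)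
    open IsRingHomomorphism ι-hom using (0#-homo)
    ε = (- 1#) ^ toℕ p
    x = M zero p
    D = det (minor M p)
    p≢q : p ≢ q
    p≢q ≡.refl = ℕ.1+n≢n (≡.sym adj)
    minors : D ≈ det (minor M q)
    minors = det-cong (λ i k → case punchIn-adjacent adj k of λ where
      (inj₁ e)        → reflexive (≡.cong (M (suc i)) e)
      (inj₂ (e , e′)) → trans (reflexive (≡.cong (M (suc i)) e))
                          (trans (sym (eq (suc i))) (reflexive (≡.cong (M (suc i)) (≡.sym e′)))))
    others : ∀ j → p ≢ j → q ≢ j → term M j ≈ 0#
    others j p≢j q≢j = trans (*-congˡ (det-adjacent-equal (punchOut-adjacent j≢p j≢q adj)
      (λ i → ≡.subst₂ (λ k l → M (suc i) k ≈ M (suc i) l)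
        (≡.sym (Fin.punchIn-punchOut j≢p)) (≡.sym (Fin.punchIn-punchOut j≢q)) (eq (suc i))))) (zeroʳ _)
      where
      j≢p : j ≢ p
      j≢p = p≢j ∘ ≡.sym
      j≢q : j ≢ q
      j≢q = q≢j ∘ ≡.sym

  infix 4 _≋_
  _≋_ : Series → Series → Set ℓ
  a ≋ b = ∀ i → a i ≈ b i

  infixl 8 _[_≔_]
  _[_≔_] : (ℕ → Series) → ℕ → Series → (ℕ → Series)
  (X [ q ≔ a ]) j with q ℕ.≟ j
  ... | yes _ = a
  ... | no  _ = X j

  ≔-at : ∀ X q a → (X [ q ≔ a ]) q ≋ a
  ≔-at X q a i with q ℕ.≟ q
  ... | yes _  = refl
  ... | no q≢q = ⊥-elim (q≢q ≡.refl)

  ≔-off : ∀ X {q} a {j} → q ≢ j → (X [ q ≔ a ]) j ≋ X j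
  ≔-off X {q} a {j} q≢j i with q ℕ.≟ j
  ... | yes q≡j = ⊥-elim (q≢j q≡j)
  ... | no  _   = refl

  -- The columns form an infinite family of infinite sequences, cut to size only here, so one family
  -- serves matrices of all sizes.
  columns : ∀ n → (ℕ → Series) → Matrix n
  columns n X i j = X (toℕ j) (toℕ i)

  -- `X′` is constrained only pointwise, so any family that agrees with the updated one will do,
  -- without function extensionality.
  AddColumn : ℕ → ℕ → ℕ → Set (c ⊔ ℓ)
  AddColumn n p q = ∀ (X X′ : ℕ → Series) s →
    (∀ j → q ≢ j → X′ j ≋ X j) → X′ q ≋ (λ i → X q i + s * X p i) →
    det (columns n X′) ≈ det (columns n X)

  -- Linearity in column `suc p` leaves a multiple of the determinant of `D`, in which columns `p`
  -- and `suc p` are equal.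
  addColumn-adjacent : ∀ n p → suc p ℕ.< n → AddColumn n p (suc p)
  addColumn-adjacent n p 1+p<n X X′ s off at = begin
    det (columns n X′)                         ≈⟨ det-linear-column q s
      (λ i → ≡.subst (λ k → X′ k (toℕ i) ≈ X k (toℕ i) + s * D k (toℕ i)) (≡.sym toℕ-q)
        (trans (at _) (+-congˡ (*-congˡ (sym (≔-at X (suc p) (X p) _))))))
      (λ i j q≢j → let q≢j′ = λ e → q≢j (Fin.toℕ-injective (≡.trans toℕ-q e)) in
        off _ q≢j′ _ , trans (off _ q≢j′ _) (sym (≔-off X (X p) q≢j′ _))) ⟩
    det (columns n X) + s * det (columns n D)  ≈⟨ +-congˡ (*-congˡ (det-adjacent-equal {p = r} {q}
      (≡.trans toℕ-q (≡.cong suc (≡.sym toℕ-r))) (λ i →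
        ≡.subst₂ (λ k l → D k (toℕ i) ≈ D l (toℕ i)) (≡.sym toℕ-r) (≡.sym toℕ-q)
          (trans (≔-off X (X p) ℕ.1+n≢n _) (sym (≔-at X (suc p) (X p) _)))))) ⟩
    det (columns n X) + s * 0#                 ≈⟨ trans (+-congˡ (zeroʳ s)) (+-identityʳ _) ⟩
    det (columns n X)                          ∎
    where
    D = X [ suc p ≔ X p ]
    p<n : p ℕ.< n
    p<n = ℕ.<-trans (ℕ.n<1+n p) 1+p<n
    r = fromℕ< p<n
    q = fromℕ< 1+p<n
    toℕ-r : toℕ r ≡ p
    toℕ-r = Fin.toℕ-fromℕ< p<n
    toℕ-q : toℕ q ≡ suc p
    toℕ-q = Fin.toℕ-fromℕ< 1+p<n

  -- An elementary matrix E_{pq}(s) is the commutator of E_{pm}(s) and E_{mq}(1).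
  addColumn-compose : ∀ n {p m q} → p ≢ m → m ≢ q → p ≢ q →
                      AddColumn n p m → AddColumn n m q → AddColumn n p q
  addColumn-compose n {p} {m} {q} p≢m m≢q p≢q addₚₘ addₘ_q X X′ s off at = begin
    det (columns n X′)  ≈⟨ addₘ_q X₃ X′ (- 1#)
      (λ j q≢j i → trans (off j q≢j i) (sym (X₃-off j q≢j i)))
      (λ i → trans (at i) (trans
        (trans (sym (+-identityʳ _)) (trans (+-congˡ (sym (-‿inverseʳ (X m i)))) (rearrange i)))
        (+-cong (sym (X₃-q i)) (*-congˡ (sym (X₃-off m (m≢q ∘ ≡.sym) i)))))) ⟩
    det (columns n X₃)  ≈⟨ addₚₘ X₂ X₃ (- s) (λ j → ≔-off X₂ _) (≔-at X₂ m _) ⟩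
    det (columns n X₂)  ≈⟨ addₘ_q X₁ X₂ 1# (λ j → ≔-off X₁ _) (≔-at X₁ q _) ⟩
    det (columns n X₁)  ≈⟨ addₚₘ X X₁ s (λ j → ≔-off X _) (≔-at X m _) ⟩
    det (columns n X)   ∎
    where
    X₁ = X [ m ≔ (λ i → X m i + s * X p i) ]
    X₂ = X₁ [ q ≔ (λ i → X₁ q i + 1# * X₁ m i) ]
    X₃ = X₂ [ m ≔ (λ i → X₂ m i + (- s) * X₂ p i) ]
    rearrange : ∀ i → X q i + s * X p i + (X m i - X m i) ≈
                (X q i + 1# * (X m i + s * X p i)) + (- 1#) * X m i
    rearrange i = sym (trans (+-cong (+-congˡ (*-identityˡ _)) (-1*x≈-x _))
      (solve 4 (λ x y z t → (x :+ (y :+ t :* z)) :- y := x :+ t :* z :+ (y :- y))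
           refl (X q i) (X m i) (X p i) s))
    X₂-m : X₂ m ≋ (λ i → X m i + s * X p i)
    X₂-m i = trans (≔-off X₁ _ (m≢q ∘ ≡.sym) i) (≔-at X m _ i)
    X₂-p : X₂ p ≋ X p
    X₂-p i = trans (≔-off X₁ _ (p≢q ∘ ≡.sym) i) (≔-off X _ (p≢m ∘ ≡.sym) i)
    X₃-q : X₃ q ≋ (λ i → X q i + 1# * (X m i + s * X p i))
    X₃-q i = trans (≔-off X₂ _ m≢q i) (trans (≔-at X₁ q _ i)
      (+-cong (≔-off X _ m≢q i) (*-congˡ (≔-at X m _ i))))
    X₃-off : ∀ j → q ≢ j → X₃ j ≋ X j
    X₃-off j q≢j i with m ℕ.≟ j
    ... | yes ≡.refl = begin
      X₂ m i + (- s) * X₂ p i               ≈⟨ +-cong (X₂-m i) (*-congˡ (X₂-p i)) ⟩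
      (X m i + s * X p i) + (- s) * X p i
        ≈⟨ solve 3 (λ x y t → (x :+ t :* y) :+ (:- t) :* y := x) refl (X m i) (X p i) s ⟩
      X m i                                 ∎
    ... | no m≢j = trans (≔-off X₁ _ q≢j i) (≔-off X _ m≢j i)

  -- Induction on the larger index, with the column just before it as the intermediate one of the
  -- commutator.
  addColumn : ∀ n {p q} → p ℕ.< q → q ℕ.< n → AddColumn n p q
  addColumn n {p} {suc q} (s≤s p≤q) 1+q<n with ℕ.m≤n⇒m<n∨m≡n p≤q
  ... | inj₂ ≡.refl = addColumn-adjacent n p 1+q<n
  ... | inj₁ p<q    = addColumn-compose n (ℕ.<⇒≢ p<q) (ℕ.1+n≢n ∘ ≡.sym) (ℕ.<⇒≢ (s≤s p≤q))
                        (addColumn n p<q (ℕ.<-trans (ℕ.n<1+n q) 1+q<n)) (addColumn-adjacent n q 1+q<n)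

  -- Linear combinations of the columns with index below `t`, kept as a list of summands so that
  -- they can be added one elementary operation at a time.
  data Span (X : ℕ → Series) : ℕ → Series → Set (c ⊔ ℓ) where
    nil  : ∀ {t a} → (∀ i → a i ≈ 0#) → Span X t a
    cons : ∀ {t a} p b s → p ℕ.< t → Span X t b → a ≋ (λ i → b i + s * X p i) → Span X t a

  addSpan : ∀ n {q} → q ℕ.< n → ∀ {X X′ a} → Span X q a →
            (∀ j → q ≢ j → X′ j ≋ X j) → X′ q ≋ X q ⊕ a →
            det (columns n X′) ≈ det (columns n X)
  addSpan n {q} q<n {X} {X′} (nil a≈0) off at = det-cong {n = n} (λ i j → X′≋X (toℕ j) (toℕ i))
    where
    X′≋X : ∀ j → X′ j ≋ X j
    X′≋X j i with q ℕ.≟ j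
    ... | yes ≡.refl = trans (at i) (trans (+-congˡ (a≈0 i)) (+-identityʳ _))
    ... | no q≢j     = off j q≢j i
  addSpan n {q} q<n {X} {X′} (cons p b s p<q span a≋) off at = trans
    (addColumn n p<q q<n D X′ s
      (λ j q≢j i → trans (off j q≢j i) (sym (≔-off X _ q≢j i)))
      (λ i → trans (at i) (trans (+-congˡ (a≋ i)) (trans (sym (+-assoc _ _ _))
        (+-cong (sym (≔-at X q _ i)) (*-congˡ (sym (≔-off X _ (ℕ.>⇒≢ p<q) i))))))))
    (addSpan n q<n span (λ j → ≔-off X _) (≔-at X q _))
    where
    D = X [ q ≔ X q ⊕ b ]

  span-cong : ∀ {X X′ t a} → (∀ j → j ℕ.< t → X j ≋ X′ j) → Span X t a → Span X′ t a
  span-cong X≋X′ (nil a≈0)              = nil a≈0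
  span-cong X≋X′ (cons p b s p<t sp a≋) = cons p b s p<t (span-cong X≋X′ sp)
    (λ i → trans (a≋ i) (+-congˡ (*-congˡ (X≋X′ p p<t i))))

  -- `P` is turned into `X` from left to right. When column `t` is treated, the columns before it
  -- already are those of `X`, so the correction in `Span X t` combines columns that are present.
  det-unitriangular : ∀ n (X P : ℕ → Series) →
    (∀ j → ∃ λ a → Span X j a × P j ≋ X j ⊕ a) → det (columns n P) ≈ det (columns n X)
  det-unitriangular n X P mon = trans
    (det-cong {n = n} (λ i j → sym (mix-≥ 0 z≤n (toℕ i))))
    (trans (go n ℕ.≤-refl)
      (det-cong {n = n} (λ i j → mix-< n (Fin.toℕ<n j) (toℕ i))))
    where
    mix : ℕ → ℕ → Series
    mix t j with t ℕ.≤? j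
    ... | yes _ = P j
    ... | no  _ = X j
    mix-≥ : ∀ t {j} → t ℕ.≤ j → mix t j ≋ P j
    mix-≥ t {j} t≤j i with t ℕ.≤? j
    ... | yes _  = refl
    ... | no t≰j = ⊥-elim (t≰j t≤j)
    mix-< : ∀ t {j} → j ℕ.< t → mix t j ≋ X j
    mix-< t {j} j<t i with t ℕ.≤? j
    ... | yes t≤j = ⊥-elim (ℕ.<⇒≱ j<t t≤j)
    ... | no _    = refl
    off : ∀ t j → t ≢ j → mix t j ≋ mix (suc t) j
    off t j t≢j i with ℕ.<-cmp t j
    ... | tri< t<j _ _ = trans (mix-≥ t (ℕ.<⇒≤ t<j) i) (sym (mix-≥ (suc t) t<j i))
    ... | tri≈ _ t≡j _ = ⊥-elim (t≢j t≡j)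
    ... | tri> _ _ j<t = trans (mix-< t j<t i) (sym (mix-< (suc t) (ℕ.m<n⇒m<1+n j<t) i))
    go : ∀ t → t ℕ.≤ n → det (columns n (mix 0)) ≈ det (columns n (mix t))
    go zero    _   = refl
    go (suc t) t<n with mon t
    ... | a , span , P≋ = trans (go t (ℕ.<⇒≤ t<n))
      (addSpan n t<n (span-cong (λ j j<t i → sym (mix-< (suc t) (ℕ.m<n⇒m<1+n j<t) i)) span)
        (off t)
        (λ i → trans (mix-≥ t ℕ.≤-refl i) (trans (P≋ i)
          (+-congʳ (sym (mix-< (suc t) (ℕ.n<1+n t) i))))))

-- Doubling, and absorption identities for binomial coefficients.

-- Reduces to two successors, so that inductions can peel off two rows and columns at once.
dbl : ℕ → ℕ
dbl zero    = zero
dbl (suc n) = suc (suc (dbl n))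

-- Absorption, by induction on `n` through Pascal's rule.
[1+k]*[1+n]C[1+k] : ∀ n k → suc k ℕ.* (suc n C suc k) ≡ suc n ℕ.* (n C k)
[1+k]*[1+n]C[1+k] zero zero = ≡.refl
[1+k]*[1+n]C[1+k] zero (suc k) = ≡.trans
  (≡.cong (suc (suc k) ℕ.*_) (k>n⇒nCk≡0 {1} {suc (suc k)} (s≤s (s≤s z≤n))))
  (≡.trans (ℕ.*-zeroʳ (suc (suc k))) (≡.sym (≡.cong (1 ℕ.*_) (k>n⇒nCk≡0 {0} {suc k} (s≤s z≤n)))))
[1+k]*[1+n]C[1+k] (suc n) zero = begin
  1 ℕ.* (suc (suc n) C 1)              ≡⟨ ≡.cong (1 ℕ.*_) (nCk+nC[k+1]≡[n+1]C[k+1] (suc n) 0) ⟨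
  1 ℕ.* (1 ℕ.+ (suc n C 1))            ≡⟨ ≡.cong suc ([1+k]*[1+n]C[1+k] n 0) ⟩
  suc (suc n) ℕ.* 1 ∎
  where open ≡.≡-Reasoning
[1+k]*[1+n]C[1+k] (suc n) (suc k) = begin
  suc (suc k) ℕ.* (suc (suc n) C suc (suc k))
    ≡⟨ ≡.cong (suc (suc k) ℕ.*_) (nCk+nC[k+1]≡[n+1]C[k+1] (suc n) (suc k)) ⟨
  suc (suc k) ℕ.* (x ℕ.+ y)  ≡⟨ ℕ.*-distribˡ-+ (suc (suc k)) x y ⟩
  (x ℕ.+ suc k ℕ.* x) ℕ.+ suc (suc k) ℕ.* y
    ≡⟨ ≡.cong₂ (λ u v → (x ℕ.+ u) ℕ.+ v) ([1+k]*[1+n]C[1+k] n k) ([1+k]*[1+n]C[1+k] n (suc k)) ⟩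
  (x ℕ.+ suc n ℕ.* (n C k)) ℕ.+ suc n ℕ.* (n C suc k)  ≡⟨ ℕ.+-assoc x _ _ ⟩
  x ℕ.+ (suc n ℕ.* (n C k) ℕ.+ suc n ℕ.* (n C suc k))
    ≡⟨ ≡.cong (x ℕ.+_) (ℕ.*-distribˡ-+ (suc n) (n C k) (n C suc k)) ⟨
  x ℕ.+ suc n ℕ.* ((n C k) ℕ.+ (n C suc k))
    ≡⟨ ≡.cong (λ u → x ℕ.+ suc n ℕ.* u) (nCk+nC[k+1]≡[n+1]C[k+1] n k) ⟩
  suc (suc n) ℕ.* x ∎
  where
  open ≡.≡-Reasoning
  x = suc n C suc k
  y = suc n C suc (suc k)

[m+n]Cm≡[m+n]Cn : ∀ m n → (m ℕ.+ n) C m ≡ (m ℕ.+ n) C n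
[m+n]Cm≡[m+n]Cn m n = ≡.trans (nCk≡nC[n∸k] (ℕ.m≤m+n m n)) (≡.cong ((m ℕ.+ n) C_) (ℕ.m+n∸m≡n m n))

-- Absorption for the complementary lower index, by the symmetry of binomial coefficients.
[1+n]*[1+m+n]Cm : ∀ m n → suc n ℕ.* (suc (m ℕ.+ n) C m) ≡ suc (m ℕ.+ n) ℕ.* ((m ℕ.+ n) C m)
[1+n]*[1+m+n]Cm m n = begin
  suc n ℕ.* (suc (m ℕ.+ n) C m)      ≡⟨ ≡.cong (λ k → suc n ℕ.* (k C m)) (ℕ.+-suc m n) ⟨
  suc n ℕ.* ((m ℕ.+ suc n) C m)      ≡⟨ ≡.cong (suc n ℕ.*_) ([m+n]Cm≡[m+n]Cn m (suc n)) ⟩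
  suc n ℕ.* ((m ℕ.+ suc n) C suc n)  ≡⟨ ≡.cong (λ k → suc n ℕ.* (k C suc n)) (ℕ.+-suc m n) ⟩
  suc n ℕ.* (suc (m ℕ.+ n) C suc n)  ≡⟨ [1+k]*[1+n]C[1+k] (m ℕ.+ n) n ⟩
  suc (m ℕ.+ n) ℕ.* ((m ℕ.+ n) C n)  ≡⟨ ≡.cong (suc (m ℕ.+ n) ℕ.*_) ([m+n]Cm≡[m+n]Cn m n) ⟨
  suc (m ℕ.+ n) ℕ.* ((m ℕ.+ n) C m)  ∎
  where open ≡.≡-Reasoning

-- Multiplication and translation of functionals on polynomials.

module Translation {c ℓ} (A : ℚ-Algebra c ℓ) where
  open ℚ-Algebra A hiding (zero)
  open Over A
  open Determinants A using (_≋_)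
  open Solver A using (solve; _:=_; _:+_; _:*_)

  -- A sequence a stands for the functional w^i ↦ a i on polynomials in w.  Then lin s a is
  -- f ↦ a((w + s) f), and τ s a is f ↦ a(f(w + s)).
  lin : Carrier → Series → Series
  lin s a i = a (suc i) + s * a i

  τ : Carrier → Series → Series
  τ s a zero    = a 0
  τ s a (suc n) = τ s (a ∘ suc) n + s * τ s a n

  τ-cong : ∀ {s t a b} → s ≈ t → a ≋ b → τ s a ≋ τ t b
  τ-cong s≈t a≋b zero    = a≋b 0
  τ-cong s≈t a≋b (suc n) = +-cong (τ-cong s≈t (a≋b ∘ suc) n) (*-cong s≈t (τ-cong s≈t a≋b n))

  τ-linear : ∀ s a t b → τ s (a ⊕ t ∙ b) ≋ τ s a ⊕ t ∙ τ s b
  τ-linear s a t b zero    = refl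
  τ-linear s a t b (suc n) = trans
    (+-cong (τ-linear s (a ∘ suc) t (b ∘ suc) n) (*-congˡ (τ-linear s a t b n)))
    (solve 6 (λ u v w z r p → u :+ p :* v :+ r :* (w :+ p :* z) := u :+ r :* w :+ p :* (v :+ r :* z)) refl
      (τ s (a ∘ suc) n) (τ s (b ∘ suc) n) (τ s a n) (τ s b n) s t)

  lin-cong : ∀ s a b → a ≋ b → lin s a ≋ lin s b
  lin-cong s _ _ a≋b i = +-cong (a≋b (suc i)) (*-congˡ (a≋b i))

  lin-linear : ∀ r a s b → lin r (a ⊕ s ∙ b) ≋ lin r a ⊕ s ∙ lin r b
  lin-linear r a s b i =
    solve 6 (λ u v w z r s → u :+ s :* v :+ r :* (w :+ s :* z) := u :+ r :* w :+ s :* (v :+ r :* z)) refl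
      (a (suc i)) (b (suc i)) (a i) (b i) r s

  lin-comm : ∀ r s a → lin r (lin s a) ≋ lin s (lin r a)
  lin-comm r s a i =
    solve 5 (λ u v w r s → u :+ s :* v :+ r :* (v :+ s :* w) := u :+ r :* v :+ s :* (v :+ r :* w)) refl
      (a (suc (suc i))) (a (suc i)) (a i) r s

  lin-comm² : ∀ r s t a → lin r (lin s (lin t a)) ≋ lin t (lin r (lin s a))
  lin-comm² r s t a i = trans
    (lin-cong r (lin s (lin t a)) (lin t (lin s a)) (lin-comm s t a) i)
    (lin-comm r t (lin s a) i)

-- The functional equation and the values of L on products of linear factors.

module Functional {c ℓ} (A : ℚ-Algebra c ℓ) (b d x : ℚ-Algebra.Carrier A) where
  open ℚ-Algebra A hiding (zero)
  open Over A
  open Determinants A using (_≋_)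
  open Translation A
  open Solver A using (solve; _:=_; _:+_; _:*_; _:-_; :-_; con)
  open SemiringMult semiring using (×-homo-+; ×-assoc-*; ×-comm-*; ×-assocˡ; ×-congˡ; ×-congʳ)
  open RingProperties ring using (-0#≈0#)
  open SetoidReasoning setoid

  q : Carrier
  q = b - x

  -- lin q multiplies by z = w + b - x, and θ k by ∏_{j = -k}^{k-1} (z - j d).
  step : ℕ → Series → Series
  step k a = lin (q - k · d) (lin (q + suc k · d) a)

  θ : ℕ → Series → Series
  θ zero    a = a
  θ (suc k) a = step k (θ k a)

  V : ℕ → Carrier
  V zero    = 1#
  V (suc k) = (- (suc k · d * suc k · d)) * V k

  -- The functional equation yields doubled values; 2 is invertible in a ℚ-algebra.
  halve : ∀ {y z} → y + y ≈ z + z → y ≈ z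
  halve {y} {z} eq = trans (sym (h y)) (trans (*-congˡ eq) (h z))
    where
    h : ∀ y → ι ½ * (y + y) ≈ y
    h = solve 1 (λ y → con ½ :* (y :+ y) := y) refl

  step-cong : ∀ k a b → a ≋ b → step k a ≋ step k b
  step-cong k a b a≋b = lin-cong _ _ _ (lin-cong _ a b a≋b)

  step-linear : ∀ k a s b → step k (a ⊕ s ∙ b) ≋ step k a ⊕ s ∙ step k b
  step-linear k a s b i = trans
    (lin-cong _ (lin r (a ⊕ s ∙ b)) (lin r a ⊕ s ∙ lin r b) (lin-linear r a s b) i)
    (lin-linear _ (lin r a) s (lin r b) i)
    where r = q + suc k · d

  θ-linear : ∀ k a s b → θ k (a ⊕ s ∙ b) ≋ θ k a ⊕ s ∙ θ k b
  θ-linear zero    a s b i = refl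
  θ-linear (suc k) a s b i = trans
    (step-cong k _ (θ k a ⊕ s ∙ θ k b) (θ-linear k a s b) i)
    (step-linear k (θ k a) s (θ k b) i)

  θ-lin : ∀ k s a → θ k (lin s a) ≋ lin s (θ k a)
  θ-lin zero    s a i = refl
  θ-lin (suc k) s a i = trans (step-cong k (θ k (lin s a)) (lin s (θ k a)) (θ-lin k s a) i)
    (lin-comm² _ _ s (θ k a) i)

  θ-step : ∀ k l a → θ k (step l a) ≋ step l (θ k a)
  θ-step k l a i = trans (θ-lin k _ (lin r a) i)
    (lin-cong _ (θ k (lin r a)) (lin r (θ k a)) (θ-lin k r a) i)
    where r = q + suc l · d

  -- (z - k d)(z + (k+1) d) = z (z + d) - k (k+1) d^2, so any two steps differ by a scalar.
  step-exchange : ∀ k l a →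
    step l a ≋ step k a ⊕ (k · d * suc k · d - l · d * suc l · d) ∙ a
  step-exchange k l a i =
    solve 7 (λ u v w q d K L →
      (u :+ (q :+ (d :+ L)) :* v) :+ (q :- L) :* (v :+ (q :+ (d :+ L)) :* w) :=
      ((u :+ (q :+ (d :+ K)) :* v) :+ (q :- K) :* (v :+ (q :+ (d :+ K)) :* w)) :+
      (K :* (d :+ K) :- L :* (d :+ L)) :* w)
    refl (a (suc (suc i))) (a (suc i)) (a i) q d (k · d) (l · d)

  -- Trades the last step of `θ (suc l)` for one that extends `θ k`; this is the recursion on `l`
  -- behind both evaluations of θ_l θ_k.
  θθ-exchange : ∀ k l a →
    θ (suc l) (θ k a) ≋ θ l (θ (suc k) a) ⊕ (k · d * suc k · d - l · d * suc l · d) ∙ θ l (θ k a)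
  θθ-exchange k l a i = trans (step-exchange k l (θ l (θ k a)) i)
    (+-congʳ (sym (θ-step l k (θ k a) i)))

  -- The relation a₁(f(w + b)) + a₂(f(w + b + d)) = e(f).  Allowing a₁ ≠ a₂ makes it stable
  -- under replacing f by (w + p) f.
  FunctionalEq : Series → Series → Series → Set ℓ
  FunctionalEq a₁ a₂ e = τ b a₁ ⊕ τ (b + d) a₂ ≋ e

  FunctionalEq-cong : ∀ {a₁ a₂ e a₁′ e′} → a₁ ≋ a₁′ → e ≋ e′ →
                      FunctionalEq a₁ a₂ e → FunctionalEq a₁′ a₂ e′
  FunctionalEq-cong eq₁ eq fe n = trans
    (+-congʳ (τ-cong refl (λ i → sym (eq₁ i)) n))
    (trans (fe n) (eq n))

  -- Translation by b turns the factor w + p into w + (p + b), and translation by b + d turns it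
  -- into w + (p + (b + d)), so the two functionals acquire different factors.
  FunctionalEq-lin : ∀ {a₁ a₂ e t₁ t₂} p → t₁ ≈ p + b → t₂ ≈ p + (b + d) →
                     FunctionalEq a₁ a₂ e → FunctionalEq (lin t₁ a₁) (lin t₂ a₂) (lin p e)
  FunctionalEq-lin {a₁} {a₂} {e} {t₁} {t₂} p eq₁ eq₂ fe n = begin
    τ b (lin t₁ a₁) n + τ (b + d) (lin t₂ a₂) n
      ≈⟨ +-cong (τ-linear b (a₁ ∘ suc) t₁ a₁ n) (τ-linear (b + d) (a₂ ∘ suc) t₂ a₂ n) ⟩
    (x₁ + t₁ * y₁) + (x₂ + t₂ * y₂)
      ≈⟨ +-cong (+-congˡ (*-congʳ eq₁)) (+-congˡ (*-congʳ eq₂)) ⟩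
    (x₁ + (p + b) * y₁) + (x₂ + (p + (b + d)) * y₂)
      ≈⟨ solve 7 (λ x₁ y₁ x₂ y₂ p b b′ → (x₁ :+ (p :+ b) :* y₁) :+ (x₂ :+ (p :+ b′) :* y₂) :=
           ((x₁ :+ b :* y₁) :+ (x₂ :+ b′ :* y₂)) :+ p :* (y₁ :+ y₂)) refl x₁ y₁ x₂ y₂ p b (b + d) ⟩
    ((x₁ + b * y₁) + (x₂ + (b + d) * y₂)) + p * (y₁ + y₂)
      -- By the definition of `τ` at `suc n`, the first bracket is the left-hand side of
      -- `fe (suc n)`.
      ≈⟨ +-cong (fe (suc n)) (*-congˡ (fe n)) ⟩
    e (suc n) + p * e n ∎
    where
    x₁ = τ b (a₁ ∘ suc) n
    y₁ = τ b a₁ n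
    x₂ = τ (b + d) (a₂ ∘ suc) n
    y₂ = τ (b + d) a₂ n

  -- `shifted (x ^_)` is the functional f ↦ f′(x), so the hypothesis reads L(f(w + b)) + L(f(w + b +
  -- d)) = 2 f′(x).
  module _ (c₀ : Series) (fe₀ : FunctionalEq c₀ c₀ (shifted (x ^_) ⊕ shifted (x ^_))) where

    private
      -- The product rule: the derivative of (w - x) f at x is f(x). The factor `1#` stands for
      -- `V 0`.
      lin-shifted : lin (- x) (shifted (x ^_) ⊕ shifted (x ^_)) ≋ 1# ∙ ((x ^_) ⊕ (x ^_))
      lin-shifted zero    = trans
        (+-cong (+-cong (+-identityʳ 1#) (+-identityʳ 1#)) (trans (*-congˡ (+-identityʳ 0#)) (zeroʳ _)))
        (trans (+-identityʳ _) (sym (*-identityˡ _)))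
      lin-shifted (suc n) = begin
        (x * e + suc n · (x * e)) + (x * e + suc n · (x * e)) + (- x) * (N + N)
          ≈⟨ +-congʳ (+-cong (+-congˡ (×-comm-* (suc n) x e)) (+-congˡ (×-comm-* (suc n) x e))) ⟨
        (x * e + x * N) + (x * e + x * N) + (- x) * (N + N)
          ≈⟨ solve 3 (λ x e N → (x :* e :+ x :* N) :+ (x :* e :+ x :* N) :+ (:- x) :* (N :+ N) := x :* e :+ x :* e)
               refl x e N ⟩
        x * e + x * e
          ≈⟨ *-identityˡ _ ⟨
        1# * (x * e + x * e) ∎
        where
        e = x ^ n
        N = suc n · e

    -- The relation fe₀ applied to multiples of ∏_{|j| ≤ k} (w - x - j d).
    FunctionalEq-θ : ∀ k → FunctionalEq
      (lin (q - k · d) (θ k c₀)) (lin (q + suc k · d) (θ k c₀)) (V k ∙ ((x ^_) ⊕ (x ^_)))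
    FunctionalEq-θ zero = FunctionalEq-cong (λ _ → refl) lin-shifted
      (FunctionalEq-lin (- x)
        (trans (+-congˡ -0#≈0#) (trans (+-identityʳ q) (+-comm b (- x))))
        (trans (+-congˡ (+-identityʳ d)) (solve 3 (λ b x d → b :- x :+ d := (:- x) :+ (b :+ d))
             refl b x d))
        fe₀)
    FunctionalEq-θ (suc k) = FunctionalEq-cong
      -- On the first side the factors must be reordered to exhibit `θ (suc k)`; the second side has
      -- that form by definition.
      (λ i → trans (lin-comm (q + m) (q - m) (lin (q - k · d) (θ k c₀)) i)
               (lin-cong (q - m) (lin (q + m) (lin (q - k · d) (θ k c₀))) (θ (suc k) c₀)
                 (lin-comm (q + m) (q - k · d) (θ k c₀)) i))
      -- At w = x the two new factors w - x - m and w - x + m contribute -m^2, the recursion of `V`.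
      (λ n → solve 4 (λ x e m v →
          v :* (x :* (x :* e) :+ x :* (x :* e)) :+ (:- x :- m) :* (v :* (x :* e :+ x :* e)) :+
          (:- x :+ m) :* (v :* (x :* e :+ x :* e) :+ (:- x :- m) :* (v :* (e :+ e))) :=
          (:- (m :* m)) :* v :* (e :+ e))
        refl x (x ^ n) m (V k))
      (FunctionalEq-lin (- x + m) (solve 3 (λ b x m → b :- x :+ m := (:- x :+ m) :+ b) refl b x m)
        (solve 4 (λ b x m d → b :- x :+ (d :+ m) := (:- x :+ m) :+ (b :+ d)) refl b x m d)
        (FunctionalEq-lin (- x - m) (solve 3 (λ b x m → b :- x :- m := (:- x :- m) :+ b)
             refl b x m)
          (solve 4 (λ b x k d → b :- x :- k := (:- x :- (d :+ k)) :+ (b :+ d)) refl b x (k · d) d)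
          (FunctionalEq-θ k)))
      where
      m = suc k · d

    -- The relation for (w - x) times the product over |j| ≤ k has right-hand side 0. Its left-hand
    -- side is L of z (z - k d) + (z + d)(z + (k+1) d) times θ_k, and this factor differs from 2 (z
    -- - k d)(z + (k+1) d) by a scalar, so induction applies.
    θ₀≈0 : ∀ k → θ k c₀ 0 ≈ 0#
    θ₀≈0 zero    = halve (fe₀ 0)
    θ₀≈0 (suc k) = halve (begin
      θ (suc k) c₀ 0 + θ (suc k) c₀ 0
        ≈⟨ solve 6 (λ u v w q d K → let m = d :+ K in
             (u :+ (q :+ m) :* v :+ (q :- K) :* (v :+ (q :+ m) :* w)) :+
             (u :+ (q :+ m) :* v :+ (q :- K) :* (v :+ (q :+ m) :* w)) :=
             ((u :+ (q :- K) :* v :+ q :* (v :+ (q :- K) :* w)) :+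
              (u :+ (q :+ m) :* v :+ (q :+ d) :* (v :+ (q :+ m) :* w)))
             :+ (:- (m :* (K :+ m))) :* w)
           refl (t 2) (t 1) (t 0) q d (k · d) ⟩
      (lin q (lin (q - k · d) t) 0 + lin (q + d) (lin (q + m) t) 0) + (- (m * (k · d + m))) * t 0
        ≈⟨ +-cong (FunctionalEq-lin (- x) (+-comm b (- x))
             (solve 3 (λ b x d → b :- x :+ d := (:- x) :+ (b :+ d))
             refl b x d) (FunctionalEq-θ k) 0)
             (trans (*-congˡ (θ₀≈0 k)) (zeroʳ _)) ⟩
      lin (- x) (V k ∙ ((x ^_) ⊕ (x ^_))) 0 + 0#
        ≈⟨ solve 4 (λ x v o z → v :* (x :* o :+ x :* o) :+ (:- x) :* (v :* (o :+ o)) :+ z := z)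
             refl x (V k) 1# 0# ⟩
      0#      ≈⟨ +-identityʳ 0# ⟨
      0# + 0# ∎)
      where
      t = θ k c₀
      m = suc k · d

    -- 2 z = (z - k d) + (z + (k+1) d) - d: the first two terms give 2 V_k by `FunctionalEq-θ`, the
    -- last gives 0 by `θ₀≈0`.
    lin-θ₀ : ∀ k → lin q (θ k c₀) 0 ≈ V k
    lin-θ₀ k = halve (begin
      (t 1 + q * t 0) + (t 1 + q * t 0)
        ≈⟨ solve 5 (λ v w q d K → (v :+ q :* w) :+ (v :+ q :* w) :=
             ((v :+ (q :- K) :* w) :+ (v :+ (q :+ (d :+ K)) :* w)) :+ (:- d) :* w) refl (t 1) (t 0) q d (k · d) ⟩
      (lin (q - k · d) t 0 + lin (q + suc k · d) t 0) + (- d) * t 0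
        ≈⟨ +-cong (FunctionalEq-θ k 0) (trans (*-congˡ (θ₀≈0 k)) (zeroʳ _)) ⟩
      V k * (1# + 1#) + 0#         ≈⟨ +-identityʳ _ ⟩
      V k * (1# + 1#)              ≈⟨ distribˡ (V k) 1# 1# ⟩
      V k * 1# + V k * 1#          ≈⟨ +-cong (*-identityʳ _) (*-identityʳ _) ⟩
      V k + V k                    ∎)
      where
      t = θ k c₀

    θθ₀≈0 : ∀ l k → θ l (θ k c₀) 0 ≈ 0#
    θθ₀≈0 zero    k = θ₀≈0 k
    θθ₀≈0 (suc l) k = trans (θθ-exchange k l c₀ 0)
      (trans (+-cong (θθ₀≈0 l (suc k)) (trans (*-congˡ (θθ₀≈0 l k)) (zeroʳ _))) (+-identityʳ _))

    -- Induction on `l` through `θθ-exchange`. Absorption expresses both C(k+l+1, k+1), which is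
    -- given, and C(k+l+1, k), which is wanted, through C(k+l, k); what remains is a polynomial
    -- identity.
    lin-θθ₀ : ∀ l k → lin q (θ l (θ k c₀)) 0 ≈ V k * V l * (((k ℕ.+ l) C k) · 1#)
    lin-θθ₀ zero k = trans (lin-θ₀ k) (sym (trans
      (*-cong (*-identityʳ _) (trans
        (×-congˡ (≡.trans (≡.cong (_C k) (ℕ.+-identityʳ k)) (nCn≡1 k))) (+-identityʳ 1#)))
      (*-identityʳ _)))
    lin-θθ₀ (suc l) k = begin
      lin q (θ (suc l) (θ k c₀)) 0
        ≈⟨ lin-cong q _ (θ l (θ (suc k) c₀) ⊕ s ∙ θ l (θ k c₀)) (θθ-exchange k l c₀) 0 ⟩
      lin q (θ l (θ (suc k) c₀) ⊕ s ∙ θ l (θ k c₀)) 0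
        ≈⟨ lin-linear q (θ l (θ (suc k) c₀)) s (θ l (θ k c₀)) 0 ⟩
      lin q (θ l (θ (suc k) c₀)) 0 + s * lin q (θ l (θ k c₀)) 0
        ≈⟨ +-cong (lin-θθ₀ l (suc k)) (*-congˡ (lin-θθ₀ l k)) ⟩
      (- (K * K)) * V k * V l * ((suc (k ℕ.+ l) C suc k) · 1#) + s * (V k * V l * C₀)
        ≈⟨ +-congʳ (solve 4 (λ K v w e → (:- (K :* K)) :* v :* w :* e := (:- K) :* v :* w :* (K :* e))
             refl K (V k) (V l) _) ⟩
      (- K) * V k * V l * (K * ((suc (k ℕ.+ l) C suc k) · 1#)) + s * (V k * V l * C₀)
        ≈⟨ +-congʳ (*-congˡ (absorb (suc k) (suc (k ℕ.+ l) C suc k) (suc (k ℕ.+ l)) ((k ℕ.+ l) C k)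
             ([1+k]*[1+n]C[1+k] (k ℕ.+ l) k))) ⟩
      (- K) * V k * V l * (suc (k ℕ.+ l) · d * C₀) + s * (V k * V l * C₀)
        ≈⟨ +-congʳ (*-congˡ (*-congʳ (+-congˡ (×-homo-+ d k l)))) ⟩
      (- K) * V k * V l * ((d + (k · d + l · d)) * C₀) + s * (V k * V l * C₀)
        ≈⟨ solve 6 (λ k l d v w e → (:- (d :+ k)) :* v :* w :* ((d :+ (k :+ l)) :* e) :+
             (k :* (d :+ k) :- l :* (d :+ l)) :* (v :* w :* e) :=
             (:- (d :+ l)) :* v :* w :* ((d :+ (k :+ l)) :* e)) refl (k · d) (l · d) d (V k) (V l) C₀ ⟩
      (- L) * V k * V l * ((d + (k · d + l · d)) * C₀)
        ≈⟨ *-congˡ (*-congʳ (+-congˡ (×-homo-+ d k l))) ⟨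
      (- L) * V k * V l * (suc (k ℕ.+ l) · d * C₀)
        ≈⟨ *-congˡ (absorb (suc l) (suc (k ℕ.+ l) C k) (suc (k ℕ.+ l)) ((k ℕ.+ l) C k)
             ([1+n]*[1+m+n]Cm k l)) ⟨
      (- L) * V k * V l * (L * ((suc (k ℕ.+ l) C k) · 1#))
        ≈⟨ *-congˡ (*-congˡ (×-congˡ (≡.cong (_C k) (ℕ.+-suc k l)))) ⟨
      (- L) * V k * V l * (L * (((k ℕ.+ suc l) C k) · 1#))
        ≈⟨ solve 4 (λ l v w e → (:- l) :* v :* w :* (l :* e) := v :* ((:- (l :* l)) :* w) :* e)
             refl L (V k) (V l) _ ⟩
      V k * ((- (L * L)) * V l) * (((k ℕ.+ suc l) C k) · 1#) ∎
      where
      K = suc k · d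
      L = suc l · d
      s = k · d * suc k · d - l · d * suc l · d
      C₀ = ((k ℕ.+ l) C k) · 1#
      absorb : ∀ m n m′ n′ → m ℕ.* n ≡ m′ ℕ.* n′ → m · d * (n · 1#) ≈ m′ · d * (n′ · 1#)
      absorb m n m′ n′ eq = trans (e m n) (trans (×-congˡ eq) (sym (e m′ n′)))
        where
        e : ∀ m n → m · d * (n · 1#) ≈ (m ℕ.* n) · d
        e m n = begin
          m · d * (n · 1#)   ≈⟨ ×-assoc-* m d _ ⟩
          m · (d * (n · 1#)) ≈⟨ ×-congʳ m (×-comm-* n d 1#) ⟩
          m · (n · (d * 1#)) ≈⟨ ×-congʳ m (×-congʳ n (*-identityʳ d)) ⟩
          m · (n · d)        ≈⟨ ×-assocˡ d m n ⟩
          (m ℕ.* n) · d      ∎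

    -- r-th differences, along k, of the rows of the matrix of lin-θθ₀.  The signs are hidden
    -- in V, hence the plus.
    T : ℕ → ℕ → Series
    T zero    k = θ k c₀
    T (suc r) k = T r (suc k) ⊕ (suc (k ℕ.+ r) · d * suc (k ℕ.+ r) · d) ∙ T r k

    θT₀≈0 : ∀ l r k → θ l (T r k) 0 ≈ 0#
    θT₀≈0 l zero    k = θθ₀≈0 l k
    θT₀≈0 l (suc r) k = trans (θ-linear l (T r (suc k)) _ (T r k) 0)
      (trans (+-cong (θT₀≈0 l r (suc k)) (trans (*-congˡ (θT₀≈0 l r k)) (zeroʳ _))) (+-identityʳ _))

    -- By Pascal's rule each difference raises the lower index by one. At k = 0 the value is V_r V_l
    -- C(l, r), which vanishes for l < r and is V_r^2 for l = r.
    lin-θT₀ : ∀ l r k → lin q (θ l (T r k)) 0 ≈ V (k ℕ.+ r) * V l * (((k ℕ.+ l) C (k ℕ.+ r)) · 1#)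
    lin-θT₀ l zero k rewrite ℕ.+-identityʳ k = lin-θθ₀ l k
    lin-θT₀ l (suc r) k rewrite ℕ.+-suc k r = begin
      lin q (θ l (T r (suc k) ⊕ s ∙ T r k)) 0
        ≈⟨ lin-cong q _ (θ l (T r (suc k)) ⊕ s ∙ θ l (T r k)) (θ-linear l (T r (suc k)) s (T r k)) 0 ⟩
      lin q (θ l (T r (suc k)) ⊕ s ∙ θ l (T r k)) 0
        ≈⟨ lin-linear q (θ l (T r (suc k))) s (θ l (T r k)) 0 ⟩
      lin q (θ l (T r (suc k))) 0 + s * lin q (θ l (T r k)) 0
        ≈⟨ +-cong (lin-θT₀ l r (suc k)) (*-congˡ (lin-θT₀ l r k)) ⟩
      (- s) * v * w * ((suc m C suc n) · 1#) + s * (v * w * ((m C n) · 1#))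
        ≈⟨ +-congʳ (*-congˡ (trans (×-congˡ (≡.sym (nCk+nC[k+1]≡[n+1]C[k+1] m n)))
             (×-homo-+ 1# (m C n) (m C suc n)))) ⟩
      (- s) * v * w * ((m C n) · 1# + (m C suc n) · 1#) + s * (v * w * ((m C n) · 1#))
        ≈⟨ solve 5 (λ s v w a b → (:- s) :* v :* w :* (a :+ b) :+ s :* (v :* w :* a) := (:- s) :* v :* w :* b)
             refl s v w _ _ ⟩
      (- s) * v * w * ((m C suc n) · 1#) ∎
      where
      m = k ℕ.+ l
      n = k ℕ.+ r
      s = suc n · d * suc n · d
      v = V n
      w = V l

dbl≡2* : ∀ m → dbl m ≡ 2 ℕ.* m
dbl≡2* zero    = ≡.refl
dbl≡2* (suc m) = ≡.trans (≡.cong (2 ℕ.+_) (dbl≡2* m)) (≡.sym (ℕ.*-suc 2 m))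

-- Determinants of block triangular matrices with 2 by 2 blocks.

module AntidiagonalBlocks {c ℓ} (A : ℚ-Algebra c ℓ) where
  open ℚ-Algebra A hiding (zero)
  open Over A
  open Determinants A using (columns; sum≈0)
  open Solver A using (solve; _:=_; _:*_; :-_)
  open SetoidReasoning setoid

  -- The product of -(h n)^2 over n < m. It unfolds at the front, where blocks are peeled off.
  -∏_² : (ℕ → Carrier) → ℕ → Carrier
  -∏_² h zero    = 1#
  -∏_² h (suc m) = (- (h 0 * h 0)) * -∏_² (h ∘ suc) m

  -- `F j i` is the entry in column j and row i. The matrix is lower block triangular with diagonal
  -- blocks [[0, h n], [h n, ∗]].
  record BlockTriangular (h : ℕ → Carrier) (F : ℕ → Series) : Set ℓ where
    field
      above : ∀ n j i → i ℕ.< dbl n → F (dbl n ℕ.+ j) i ≈ 0#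
      diag  : ∀ n → F (dbl n) (dbl n) ≈ 0#
      lower : ∀ n → F (dbl n) (suc (dbl n)) ≈ h n
      upper : ∀ n → F (suc (dbl n)) (dbl n) ≈ h n

  open BlockTriangular

  tail : ∀ {h F} → BlockTriangular h F →
         BlockTriangular (h ∘ suc) (λ j i → F (suc (suc j)) (suc (suc i)))
  tail bt .above n j i i<2n = above bt (suc n) j _ (s≤s (s≤s i<2n))
  tail bt .diag n  = diag bt (suc n)
  tail bt .lower n = lower bt (suc n)
  tail bt .upper n = upper bt (suc n)

  -- Row 0 vanishes outside column 1, and row 1 without column 1 vanishes outside column 0. A single
  -- term of the two nested expansions survives, with sign -1.
  det-peel : ∀ N {h F} → BlockTriangular h F →
             det (columns (suc (suc N)) F) ≈
             (- (h 0 * h 0)) * det (columns N (λ j i → F (suc (suc j)) (suc (suc i))))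
  det-peel N {h} {F} bt = begin
    1# * F 0 0 * _ + ((- 1# * 1#) * F 1 0 * (1# * F 0 1 * D + _) + _)
      ≈⟨ +-cong (trans (*-congʳ (trans (*-congˡ (diag bt 0)) (zeroʳ _))) (zeroˡ _))
           (+-cong (*-cong (*-congˡ (upper bt 0)) (+-cong (*-congʳ (*-congˡ (lower bt 0)))
               (sum≈0 {N} (λ j → vanish (above bt 1 (toℕ j) 1 (s≤s (s≤s z≤n)))))))
             (sum≈0 {N} (λ j → vanish (above bt 1 (toℕ j) 0 (s≤s z≤n))))) ⟩
    0# + ((- 1# * 1#) * h 0 * (1# * h 0 * D + 0#) + 0#)
      ≈⟨ trans (+-identityˡ _) (trans (+-identityʳ _) (*-congˡ (+-identityʳ _))) ⟩
    (- 1# * 1#) * h 0 * (1# * h 0 * D)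
      ≈⟨ *-cong (*-congʳ (*-identityʳ _)) (*-congʳ (*-identityˡ _)) ⟩
    (- 1#) * h 0 * (h 0 * D)
      ≈⟨ solve 3 (λ o h D → (:- o) :* h :* (h :* D) := o :* ((:- (h :* h)) :* D))
           refl 1# (h 0) D ⟩
    1# * ((- (h 0 * h 0)) * D)
      ≈⟨ *-identityˡ _ ⟩
    (- (h 0 * h 0)) * D ∎
    where
    D = det (columns N (λ j i → F (suc (suc j)) (suc (suc i))))
    vanish : ∀ {s y z} → y ≈ 0# → s * y * z ≈ 0#
    vanish y≈0 = trans (*-congʳ (trans (*-congˡ y≈0) (zeroʳ _))) (zeroˡ _)

  det-even : ∀ m {h F} → BlockTriangular h F → det (columns (dbl m) F) ≈ -∏_² h m
  det-even zero    bt = refl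
  det-even (suc m) bt = trans (det-peel (dbl m) bt) (*-congˡ (det-even m (tail bt)))

  -- Once the full blocks are peeled off, the zero corner of the next one is left.
  det-odd : ∀ m {h F} → BlockTriangular h F → det (columns (suc (dbl m)) F) ≈ 0#
  det-odd zero bt = trans (+-identityʳ _) (trans (*-congʳ (trans (*-congˡ (diag bt 0)) (zeroʳ _))) (zeroˡ _))
  det-odd (suc m) bt = trans (det-peel (suc (dbl m)) bt) (trans (*-congˡ (det-odd m (tail bt))) (zeroʳ _))

-- Reduction of the Hankel matrix to block triangular form.

module Hankel {c ℓ} (A : ℚ-Algebra c ℓ) (b d x : ℚ-Algebra.Carrier A)
  (c₀ : Over.Series A)
  (fe₀ : Functional.FunctionalEq A b d x c₀ c₀
    (Over._⊕_ A (Over.shifted A (Over._^_ A x)) (Over.shifted A (Over._^_ A x)))) where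
  open ℚ-Algebra A hiding (zero)
  open Over A
  open Determinants A
  open Translation A
  open Functional A b d x
  open AntidiagonalBlocks A
  open Solver A using (solve; _:=_; _:+_; _:*_)
  open SetoidReasoning setoid
  open SemiringMult semiring using (×-congˡ)

  t : ℕ → Series
  t n = T c₀ fe₀ n 0

  -- The functional `a` kills every polynomial of degree below `n`.
  Vanishes : ℕ → Series → Set ℓ
  Vanishes n a = ∀ {i} → i ℕ.< n → a i ≈ 0#

  vanishes-suc : ∀ {n a} → Vanishes n a → a n ≈ 0# → Vanishes (suc n) a
  vanishes-suc {n} v aₙ≈0 {i} i<1+n with ℕ.m≤n⇒m<n∨m≡n (ℕ.≤-pred i<1+n)
  ... | inj₁ i<n    = v i<n
  ... | inj₂ ≡.refl = aₙ≈0

  lin-leading : ∀ s n a → Vanishes (suc n) a → lin s a n ≈ a (suc n)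
  lin-leading s n a v = trans (+-congˡ (trans (*-congˡ (v ℕ.≤-refl)) (zeroʳ s))) (+-identityʳ _)

  -- θ_k is monic of degree 2k, so θ_k w^n is w^(2k+n) plus terms of lower degree, which `a` kills.
  θ-leading : ∀ k n a → Vanishes (dbl k ℕ.+ n) a → θ k a n ≈ a (dbl k ℕ.+ n)
  θ-leading zero    n a v = refl
  θ-leading (suc k) n a v = begin
    lin _ (lin r (θ k a)) n      ≈⟨ lin-leading _ n (lin r (θ k a)) (λ {i} i≤n →
      trans (lin-leading r i (θ k a) (λ {j} j≤i →
        zeros (ℕ.≤-trans j≤i (ℕ.m≤n⇒m≤1+n i≤n)))) (zeros (s≤s i≤n))) ⟩
    lin r (θ k a) (suc n)        ≈⟨ lin-leading r (suc n) (θ k a) (λ j≤n → zeros j≤n) ⟩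
    θ k a (suc (suc n))
      ≈⟨ θ-leading k (suc (suc n)) a (λ i< → v (ℕ.<-≤-trans i< (ℕ.≤-reflexive eq))) ⟩
    a (dbl k ℕ.+ suc (suc n))    ≡⟨ ≡.cong a eq ⟩
    a (suc (suc (dbl k ℕ.+ n)))  ∎
    where
    r = q + suc k · d
    eq : dbl k ℕ.+ suc (suc n) ≡ suc (suc (dbl k ℕ.+ n))
    eq = ≡.trans (ℕ.+-suc (dbl k) (suc n)) (≡.cong suc (ℕ.+-suc (dbl k) n))
    zeros : ∀ {i} → i ℕ.< suc (suc n) → θ k a i ≈ 0#
    zeros {i} i< = trans (θ-leading k i a (λ j< → v (ℕ.<-trans j< lt))) (v lt)
      where
      lt : dbl k ℕ.+ i ℕ.< suc (suc (dbl k ℕ.+ n))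
      lt = ≡.subst (dbl k ℕ.+ i ℕ.<_) eq (ℕ.+-monoʳ-< (dbl k) i<)

  θ-leading₀ : ∀ k a → Vanishes (dbl k) a → θ k a 0 ≈ a (dbl k)
  θ-leading₀ k a v = trans
    (θ-leading k 0 a (λ i< → v (ℕ.<-≤-trans i< (ℕ.≤-reflexive (ℕ.+-identityʳ _)))))
    (reflexive (≡.cong a (ℕ.+-identityʳ _)))

  lin-θ-leading₀ : ∀ k a → Vanishes (suc (dbl k)) a → lin q (θ k a) 0 ≈ a (suc (dbl k))
  lin-θ-leading₀ k a v = trans
    (lin-leading q 0 (θ k a) θka₀≈0)
    (trans (θ-leading k 1 a (λ i< → v (ℕ.<-≤-trans i< (ℕ.≤-reflexive eq)))) (reflexive (≡.cong a eq)))
    where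
    eq = ℕ.+-comm (dbl k) 1
    θka₀≈0 : Vanishes 1 (θ k a)
    θka₀≈0 {zero}  _        = trans (θ-leading₀ k a (λ i< → v (ℕ.m<n⇒m<1+n i<))) (v ℕ.≤-refl)
    θka₀≈0 {suc _} (s≤s ())

  -- The polynomials θ_k and z θ_k have degrees 2k and 2k + 1. As f ↦ L(t_n f) kills the former, and
  -- the latter for k < n, it kills the powers of w one after another up to w^(2n).
  t-vanishes : ∀ n k → k ℕ.≤ n → Vanishes (suc (dbl k)) (t n)
  t-vanishes n k k≤n = vanishes-suc {dbl k} {t n} (below k k≤n)
    (trans (sym (θ-leading₀ k (t n) (below k k≤n))) (θT₀≈0 c₀ fe₀ k n 0))
    where
    below : ∀ k → k ℕ.≤ n → Vanishes (dbl k) (t n)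
    below zero    _   ()
    below (suc k) k<n = vanishes-suc {_} {t n} (t-vanishes n k (ℕ.<⇒≤ k<n)) (begin
      t n (suc (dbl k))      ≈⟨ lin-θ-leading₀ k (t n) (t-vanishes n k (ℕ.<⇒≤ k<n)) ⟨
      lin q (θ k (t n)) 0    ≈⟨ lin-θT₀ c₀ fe₀ k n 0 ⟩
      V n * V k * ((k C n) · 1#) ≈⟨ *-congˡ (×-congˡ (k>n⇒nCk≡0 k<n)) ⟩
      V n * V k * 0#         ≈⟨ zeroʳ _ ⟩
      0#                     ∎)

  t-leading : ∀ n → t n (suc (dbl n)) ≈ V n * V n
  t-leading n = begin
    t n (suc (dbl n))           ≈⟨ lin-θ-leading₀ n (t n) (t-vanishes n n ℕ.≤-refl) ⟨
    lin q (θ n (t n)) 0         ≈⟨ lin-θT₀ c₀ fe₀ n n 0 ⟩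
    V n * V n * ((n C n) · 1#)  ≈⟨ *-congˡ (trans (×-congˡ (nCn≡1 n)) (+-identityʳ 1#)) ⟩
    V n * V n * 1#              ≈⟨ *-identityʳ _ ⟩
    V n * V n                   ∎

  -- `F 0` lists t_0, z t_0, t_1, z t_1, and so on; the first argument lets the recursion advance by
  -- two columns.
  F : ℕ → ℕ → Series
  F r zero          = t r
  F r (suc zero)    = lin q (t r)
  F r (suc (suc j)) = F (suc r) j

  F-dbl : ∀ n r j → F r (dbl n ℕ.+ j) ≡ F (n ℕ.+ r) j
  F-dbl zero    r j = ≡.refl
  F-dbl (suc n) r j = ≡.trans (F-dbl n (suc r) j) (≡.cong (λ k → F k j) (ℕ.+-suc n r))

  F-vanishes : ∀ r j → Vanishes (dbl r) (F r j)
  F-vanishes r zero          i< = t-vanishes r r ℕ.≤-refl (ℕ.m<n⇒m<1+n i<)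
  F-vanishes r (suc zero) {i} i< = trans
    (lin-leading q i (t r) (λ j≤i → t-vanishes r r ℕ.≤-refl (ℕ.≤-trans j≤i (ℕ.m<n⇒m<1+n i<))))
    (t-vanishes r r ℕ.≤-refl (s≤s i<))
  F-vanishes r (suc (suc j)) i< = F-vanishes (suc r) j (ℕ.m<n⇒m<1+n (ℕ.m<n⇒m<1+n i<))

  F-0 : ∀ n j → F 0 (dbl n ℕ.+ j) ≡ F n j
  F-0 n j = ≡.trans (F-dbl n 0 j) (≡.cong (λ k → F k j) (ℕ.+-identityʳ n))

  F-even : ∀ n → F 0 (dbl n) ≡ t n
  F-even n = ≡.trans (≡.cong (F 0) (≡.sym (ℕ.+-identityʳ (dbl n)))) (F-0 n 0)

  F-odd : ∀ n → F 0 (suc (dbl n)) ≡ lin q (t n)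
  F-odd n = ≡.trans (≡.cong (F 0) (ℕ.+-comm 1 (dbl n))) (F-0 n 1)

  F-blockTriangular : BlockTriangular (λ n → V n * V n) (F 0)
  F-blockTriangular = record
    { above = λ n j i i< → trans (reflexive (≡.cong (λ f → f i) (F-0 n j))) (F-vanishes n j i<)
    ; diag  = λ n → trans (reflexive (≡.cong (λ f → f (dbl n)) (F-even n)))
        (t-vanishes n n ℕ.≤-refl ℕ.≤-refl)
    ; lower = λ n → trans (reflexive (≡.cong (λ f → f (suc (dbl n))) (F-even n))) (t-leading n)
    -- z w^(2n) and w^(2n+1) differ by a multiple of w^(2n), which t_n kills.
    ; upper = λ n → trans (reflexive (≡.cong (λ f → f (dbl n)) (F-odd n)))
        (trans (lin-leading q (dbl n) (t n) (t-vanishes n n ℕ.≤-refl)) (t-leading n))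
    }

  σ : ℕ → Series
  σ j i = c₀ (j ℕ.+ i)

  -- `p` is f ↦ L(g f) for a monic polynomial g of degree j; `σ j` is the case g = w^j.
  Monic : ℕ → Series → Set _
  Monic j p = ∃ λ a → Span σ j a × p ≋ σ j ⊕ a

  span-weaken : ∀ {m n a} → m ℕ.≤ n → Span σ m a → Span σ n a
  span-weaken m≤n (nil a≈0)               = nil a≈0
  span-weaken m≤n (cons p b s p<m sp a≋) = cons p b s (ℕ.<-≤-trans p<m m≤n) (span-weaken m≤n sp) a≋

  span-resp : ∀ {n a b} → b ≋ a → Span σ n a → Span σ n b
  span-resp b≋a (nil a≈0)              = nil (λ i → trans (b≋a i) (a≈0 i))
  span-resp b≋a (cons p b′ s p<n sp a≋) = cons p b′ s p<n sp (λ i → trans (b≋a i) (a≋ i))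

  span-add : ∀ {n a b} s → Span σ n a → Span σ n b → Span σ n (a ⊕ s ∙ b)
  span-add {n} {a} {b} s spa (nil b≈0) = span-resp
    (λ i → trans (+-congˡ (trans (*-congˡ (b≈0 i)) (zeroʳ s))) (+-identityʳ _))
    spa
  span-add {n} {a} {b} s spa (cons p b′ r p<n sp b≋) =
    cons p (a ⊕ s ∙ b′) (s * r) p<n (span-add s spa sp)
    (λ i → trans (+-congˡ (*-congˡ (b≋ i)))
      (solve 5 (λ a b c r s → a :+ s :* (b :+ r :* c) := a :+ s :* b :+ s :* r :* c)
           refl (a i) (b′ i) (σ p i) r s))

  span-lin : ∀ {n a} s → Span σ n a → Span σ (suc n) (lin s a)
  span-lin {n} s (nil a≈0) = nil (λ i →
    trans (+-cong (a≈0 _) (trans (*-congˡ (a≈0 _)) (zeroʳ s))) (+-identityʳ _))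
  span-lin {n} {a} s (cons p b r p<n sp a≋) =
    -- The summand r w^p becomes r w^(p+1) + s r w^p, which is why the bound grows by one.
    cons p (lin s b ⊕ r ∙ σ (suc p)) (s * r) (ℕ.m<n⇒m<1+n p<n)
      (cons (suc p) (lin s b) r (s≤s p<n) (span-lin s sp) (λ _ → refl))
      (λ i → trans (lin-cong s a (b ⊕ r ∙ σ p) a≋ i)
        (trans (+-congʳ (+-congˡ (*-congˡ (reflexive (≡.cong c₀ (ℕ.+-suc p i))))))
        (solve 6 (λ b b′ c c′ r s →
           b′ :+ r :* c′ :+ s :* (b :+ r :* c) := b′ :+ s :* b :+ r :* c′ :+ s :* r :* c) refl
          (b i) (b (suc i)) (σ p i) (σ (suc p) i) r s)))

  monic-lin : ∀ {n p} s → Monic n p → Monic (suc n) (lin s p)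
  monic-lin {n} {p} s (a , sp , p≋) =
    lin s a ⊕ s ∙ σ n ,
    span-add s (span-lin s sp)
      (cons n (λ _ → 0#) 1# (ℕ.n<1+n n) (nil (λ _ → refl)) (λ i → sym (trans (+-identityˡ _) (*-identityˡ _)))) ,
    λ i → trans (lin-cong s p (σ n ⊕ a) p≋ i)
      (trans (+-congʳ (+-congʳ (reflexive (≡.cong c₀ (ℕ.+-suc n i)))))
      (solve 5 (λ c c′ a a′ s → c′ :+ a′ :+ s :* (c :+ a) := c′ :+ (a′ :+ s :* a :+ s :* c)) refl
        (σ n i) (σ (suc n) i) (a i) (a (suc i)) s))

  monic-add : ∀ {m n p r} s → n ℕ.< m → Monic m p → Monic n r → Monic m (p ⊕ s ∙ r)
  monic-add {m} {n} {p} {r} s n<m (a , spa , p≋) (b , spb , r≋) =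
    (a ⊕ s ∙ b) ⊕ s ∙ σ n ,
    cons n (a ⊕ s ∙ b) s n<m (span-add s spa (span-weaken (ℕ.<⇒≤ n<m) spb)) (λ _ → refl) ,
    λ i → trans (+-cong (p≋ i) (*-congˡ (r≋ i)))
      (solve 5 (λ c c′ a b s → c′ :+ a :+ s :* (c :+ b) := c′ :+ (a :+ s :* b :+ s :* c)) refl
        (σ n i) (σ m i) (a i) (b i) s)

  monic-θ : ∀ k → Monic (dbl k) (θ k c₀)
  monic-θ zero    = (λ _ → 0#) , nil (λ _ → refl) , λ i → sym (+-identityʳ _)
  monic-θ (suc k) = monic-lin _ (monic-lin _ (monic-θ k))

  -- The leading term is that of θ_(k+r); each difference adds only lower degrees to it.
  monic-T : ∀ r k → Monic (dbl (k ℕ.+ r)) (T c₀ fe₀ r k)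
  monic-T zero    k = ≡.subst (λ n → Monic (dbl n) (θ k c₀)) (≡.sym (ℕ.+-identityʳ k)) (monic-θ k)
  monic-T (suc r) k = ≡.subst (λ n → Monic (dbl n) (T c₀ fe₀ (suc r) k)) (≡.sym (ℕ.+-suc k r))
    (monic-add _ (ℕ.m<n⇒m<1+n (ℕ.n<1+n _)) (monic-T r (suc k)) (monic-T r k))

  monic-F : ∀ r j → Monic (j ℕ.+ dbl r) (F r j)
  monic-F r zero          = monic-T r 0
  monic-F r (suc zero)    = monic-lin q (monic-T r 0)
  monic-F r (suc (suc j)) = ≡.subst (λ n → Monic n (F (suc r) j))
    (≡.trans (ℕ.+-suc j _) (≡.cong suc (ℕ.+-suc j _))) (monic-F (suc r) j)

  det-columns : ∀ n → det (columns n (F 0)) ≈ det {n} (λ i j → c₀ (toℕ i ℕ.+ toℕ j))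
  det-columns n = trans
    (det-unitriangular n σ (F 0) (λ j → ≡.subst (λ k → Monic k (F 0 j)) (ℕ.+-identityʳ j) (monic-F 0 j)))
    (det-cong {n} (λ i j → reflexive (≡.cong c₀ (ℕ.+-comm (toℕ j) (toℕ i)))))

  -- `H n` has size n + 1, so an even index means an odd size.
  H₂ₘ≈0 : ∀ m → H (2 ℕ.* m) c₀ ≈ 0#
  H₂ₘ≈0 m = trans (reflexive (≡.cong (λ n → H n c₀) (≡.sym (dbl≡2* m))))
    (trans (sym (det-columns (suc (dbl m)))) (det-odd m F-blockTriangular))

  H₂ₘ₊₁ : ∀ m → H (suc (2 ℕ.* m)) c₀ ≈ -∏_² (λ n → V n * V n) (suc m)
  H₂ₘ₊₁ m = trans (reflexive (≡.cong (λ n → H (suc n) c₀) (≡.sym (dbl≡2* m))))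
    (trans (sym (det-columns (dbl (suc m)))) (det-even (suc m) F-blockTriangular))

∏ℓ!⁸-suc : ∀ m → ∏ℓ!⁸ (suc m) ≡ ∏ℓ!⁸ m ℕ.* (suc m !) ℕ.^ 8
∏ℓ!⁸-suc m = begin
  product (applyUpTo f (suc m))                 ≡⟨ ≡.cong product (applyUpTo-∷ʳ f m) ⟨
  product (applyUpTo f m ++ (f m ∷ []))     ≡⟨ product-++ (applyUpTo f m) (f m ∷ []) ⟩
  ∏ℓ!⁸ m ℕ.* (f m ℕ.* 1)                        ≡⟨ ≡.cong (∏ℓ!⁸ m ℕ.*_) (ℕ.*-identityʳ (f m)) ⟩
  ∏ℓ!⁸ m ℕ.* f m                                ∎
  where
  open ≡.≡-Reasoning
  f : ℕ → ℕ
  f k = (suc k !) ℕ.^ 8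

-- Exponential generating functions and binomial convolution.

module BinomialConvolution {c ℓ} (A : ℚ-Algebra c ℓ) where
  open ℚ-Algebra A hiding (zero)
  open Over A
  open Determinants A using (_≋_)
  open Translation A
  open Solver A using (solve; _:=_; _:*_)
  open RingMorphisms ℚ.+-*-rawRing rawRing using (module IsRingHomomorphism)
  open IsRingHomomorphism ι-hom
  open SemiringMult semiring using (×-assoc-*; ×-comm-*; ×-assocˡ; ×-congˡ; ×-congʳ; ×-homo-+)
  open CommutativeMonoidMult +-commutativeMonoid using (×-distrib-+)
  open SemiringSum semiring using (sum-cong-≋; ∑-distrib-+; *-distribˡ-sum; sum)
  open SetoidReasoning setoid

  ⊛-cong : ∀ f f′ g g′ → f ≋ f′ → g ≋ g′ → f ⊛ g ≋ f′ ⊛ g′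
  ⊛-cong f f′ g g′ f≋ g≋ n = sum-cong-≋ {suc n}
    {λ i → f (toℕ i) * g (n ℕ.∸ toℕ i)} {λ i → f′ (toℕ i) * g′ (n ℕ.∸ toℕ i)}
    (λ i → *-cong (f≋ (toℕ i)) (g≋ (n ℕ.∸ toℕ i)))

  ⊛-distribˡ : ∀ f g h → f ⊛ (g ⊕ h) ≋ f ⊛ g ⊕ f ⊛ h
  ⊛-distribˡ f g h n = trans
    (sum-cong-≋ {suc n} {λ i → f (toℕ i) * (g ⊕ h) (n ℕ.∸ toℕ i)}
      {λ i → f (toℕ i) * g (n ℕ.∸ toℕ i) + f (toℕ i) * h (n ℕ.∸ toℕ i)}
      (λ i → distribˡ (f (toℕ i)) (g (n ℕ.∸ toℕ i)) (h (n ℕ.∸ toℕ i))))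
    (∑-distrib-+ {suc n} (λ i → f (toℕ i) * g (n ℕ.∸ toℕ i)) (λ i → f (toℕ i) * h (n ℕ.∸ toℕ i)))

  ⊛-∙ : ∀ f a g → f ⊛ (a ∙ g) ≋ a ∙ (f ⊛ g)
  ⊛-∙ f a g n = trans
    (sum-cong-≋ {suc n} {λ i → f (toℕ i) * (a * g (n ℕ.∸ toℕ i))}
      {λ i → a * (f (toℕ i) * g (n ℕ.∸ toℕ i))}
      (λ i → solve 3 (λ f a g → f :* (a :* g) := a :* (f :* g))
           refl (f (toℕ i)) a (g (n ℕ.∸ toℕ i))))
    (sym (*-distribˡ-sum {suc n} a (λ i → f (toℕ i) * g (n ℕ.∸ toℕ i))))

  n·sum : ∀ m {n} (f : Fin n → Carrier) → m · sum f ≈ sum (λ i → m · f i)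
  n·sum m {n} f = begin
    m · sum f               ≈⟨ ×-congʳ m (*-identityˡ _) ⟨
    m · (1# * sum f)        ≈⟨ ×-assoc-* m 1# _ ⟨
    m · 1# * sum f          ≈⟨ *-distribˡ-sum {n} (m · 1#) f ⟩
    sum (λ i → m · 1# * f i)
      ≈⟨ sum-cong-≋ {n} (λ i → trans (×-assoc-* m 1# (f i)) (×-congʳ m (*-identityˡ (f i)))) ⟩
    sum (λ i → m · f i)     ∎

  -- On power series in t, `E` is t d/dt and `D` is d/dt.
  E D : Series → Series
  E f k = k · f k
  D f k = suc k · f (suc k)

  -- The Leibniz rule is proved first for t d/dt, which preserves degrees: termwise it is n = i + (n
  -- - i).
  E-⊛ : ∀ f g → E (f ⊛ g) ≋ E f ⊛ g ⊕ f ⊛ E g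
  E-⊛ f g n = trans
    (n·sum n {suc n} (λ i → f (toℕ i) * g (n ℕ.∸ toℕ i))) (trans
    (sum-cong-≋ {suc n} {λ i → n · (f (toℕ i) * g (n ℕ.∸ toℕ i))}
      {λ i → E f (toℕ i) * g (n ℕ.∸ toℕ i) + f (toℕ i) * E g (n ℕ.∸ toℕ i)} termwise)
    (∑-distrib-+ {suc n} (λ i → E f (toℕ i) * g (n ℕ.∸ toℕ i))
      (λ i → f (toℕ i) * E g (n ℕ.∸ toℕ i))))
    where
    termwise : ∀ (i : Fin (suc n)) → n · (f (toℕ i) * g (n ℕ.∸ toℕ i)) ≈
               E f (toℕ i) * g (n ℕ.∸ toℕ i) + f (toℕ i) * E g (n ℕ.∸ toℕ i)
    termwise i = begin
      n · (u * v)              ≈⟨ ×-congˡ (ℕ.m+[n∸m]≡n (ℕ.≤-pred (Fin.toℕ<n i))) ⟨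
      (k ℕ.+ l) · (u * v)      ≈⟨ ×-homo-+ (u * v) k l ⟩
      k · (u * v) + l · (u * v) ≈⟨ +-cong (×-assoc-* k u v) (×-comm-* l u v) ⟨
      k · u * v + u * l · v    ∎
      where
      k = toℕ i
      l = n ℕ.∸ toℕ i
      u = f k
      v = g l

  ⊛-E-suc : ∀ n f g → (f ⊛ E g) (suc n) ≈ (f ⊛ D g) n
  ⊛-E-suc zero    f g = +-congˡ (trans (+-identityʳ _) (zeroʳ _))
  ⊛-E-suc (suc n) f g = +-congˡ (⊛-E-suc n (f ∘ suc) g)

  -- This is `E-⊛` one degree higher, where the terms with `E f 0` and `E g 0` vanish.
  D-⊛ : ∀ f g → D (f ⊛ g) ≋ D f ⊛ g ⊕ f ⊛ D g
  D-⊛ f g n = trans (E-⊛ f g (suc n))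
    (+-cong (trans (+-congʳ (zeroˡ _)) (+-identityˡ _)) (⊛-E-suc n f g))

  ι-· : ∀ n p → ι (n Rational.· p) ≈ n · ι p
  ι-· zero    p = 0#-homo
  ι-· (suc n) p = trans (+-homo p (n Rational.· p)) (+-congˡ (ι-· n p))

  k!·1/k! : ∀ k → (k !) · ι (1/ k !) ≈ 1#
  k!·1/k! k = trans (sym (ι-· (k !) (1/ k !))) (trans (⟦⟧-cong (n·1/n≡1 (k !) {{k ℕ.!≢0}})) 1#-homo)

  k!·[a/k!] : ∀ k a → (k !) · (a * ι (1/ k !)) ≈ a
  k!·[a/k!] k a = trans (sym (×-comm-* (k !) a _)) (trans (*-congˡ (k!·1/k! k)) (*-identityʳ a))

  [1+k]!· : ∀ k a → (suc k !) · a ≈ (k !) · (suc k · a)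
  [1+k]!· k a = trans (×-congˡ (ℕ.*-comm (suc k) (k !))) (sym (×-assocˡ a (k !) (suc k)))

  [1+k]·1/[1+k]! : ∀ k → suc k · ι (1/ suc k !) ≈ ι (1/ k !)
  [1+k]·1/[1+k]! k = begin
    e′                           ≈⟨ k!·[a/k!] k e′ ⟨
    (k !) · (e′ * ι (1/ k !))    ≈⟨ ×-assoc-* (k !) e′ _ ⟨
    (k !) · e′ * ι (1/ k !)      ≈⟨ *-congʳ (trans (sym ([1+k]!· k _)) (k!·1/k! (suc k))) ⟩
    1# * ι (1/ k !)              ≈⟨ *-identityˡ _ ⟩
    ι (1/ k !)                   ∎
    where e′ = suc k · ι (1/ suc k !)

  egf : Series → Series
  egf s k = s k * ι (1/ k !)

  D-egf : ∀ s → D (egf s) ≋ egf (s ∘ suc)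
  D-egf s k = trans (sym (×-comm-* (suc k) (s (suc k)) _)) (*-congˡ ([1+k]·1/[1+k]! k))

  D-exp : ∀ a → D (exp a) ≋ a ∙ exp a
  D-exp a k = trans (D-egf (a ^_) k) (*-assoc a (a ^ k) _)

  -- Both sides are the binomial convolution of `s` with the powers of `a`. Differentiating the
  -- product of series gives the recursion that defines `τ`.
  egf-⊛-exp : ∀ a n s → (n !) · (egf s ⊛ exp a) n ≈ τ a s n
  egf-⊛-exp a zero s = begin
    1 · (s 0 * ι (1/ 0 !) * (1# * ι (1/ 0 !)) + 0#)
      ≈⟨ ×-congʳ 1 (trans (+-identityʳ _) (trans (*-congˡ (trans (*-identityˡ _) 1#-homo)) (*-identityʳ _))) ⟩
    1 · (s 0 * ι (1/ 0 !))                           ≈⟨ k!·[a/k!] 0 (s 0) ⟩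
    s 0                                              ∎
  egf-⊛-exp a (suc n) s = begin
    (suc n !) · (egf s ⊛ exp a) (suc n)       ≈⟨ [1+k]!· n _ ⟩
    (n !) · D (egf s ⊛ exp a) n               ≈⟨ ×-congʳ (n !) (D-⊛ (egf s) (exp a) n) ⟩
    (n !) · ((D (egf s) ⊛ exp a) n + (egf s ⊛ D (exp a)) n)
      ≈⟨ ×-congʳ (n !) (+-cong
           (⊛-cong (D (egf s)) (egf (s ∘ suc)) (exp a) (exp a) (D-egf s) (λ _ → refl) n)
           (trans (⊛-cong (egf s) (egf s) (D (exp a)) (a ∙ exp a) (λ _ → refl) (D-exp a) n)
             (⊛-∙ (egf s) a (exp a) n))) ⟩
    (n !) · ((egf (s ∘ suc) ⊛ exp a) n + a * (egf s ⊛ exp a) n)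
      ≈⟨ ×-distrib-+ _ _ (n !) ⟩
    (n !) · (egf (s ∘ suc) ⊛ exp a) n + (n !) · (a * (egf s ⊛ exp a) n)
      ≈⟨ +-cong (egf-⊛-exp a n (s ∘ suc)) (trans (sym (×-comm-* (n !) a _)) (*-congˡ (egf-⊛-exp a n s))) ⟩
    τ a (s ∘ suc) n + a * τ a s n ∎

  -- Turns the constants in the generating functions into exponentials, so both Euler sequences take
  -- the shape required by `shifted-functional`.
  const≋exp0 : ∀ a → const a ≋ a ∙ exp 0#
  const≋exp0 a zero    = sym (trans (*-congˡ (trans (*-identityˡ _) 1#-homo)) (*-identityʳ a))
  const≋exp0 a (suc k) = sym (trans (*-congˡ (trans (*-congʳ (zeroˡ _)) (zeroˡ _))) (zeroʳ a))

  -- `shifted s` is f ↦ s(f′), and differentiation commutes with translation.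
  τ-shifted : ∀ a s → τ a (shifted s) ≋ shifted (τ a s)
  τ-shifted a s zero    = refl
  τ-shifted a s (suc n) = begin
    τ a (shifted s ∘ suc) n + a * τ a (shifted s) n
      ≈⟨ +-cong (τ-cong refl split n) (*-congˡ (τ-shifted a s n)) ⟩
    τ a (s ⊕ 1# ∙ shifted (s ∘ suc)) n + a * shifted (τ a s) n
      ≈⟨ +-congʳ (trans (τ-linear a s 1# (shifted (s ∘ suc)) n)
           (+-congˡ (trans (*-identityˡ _) (τ-shifted a (s ∘ suc) n)))) ⟩
    (τ a s n + shifted (τ a (s ∘ suc)) n) + a * shifted (τ a s) n
      ≈⟨ +-assoc _ _ _ ⟩
    τ a s n + (shifted (τ a (s ∘ suc)) n + a * shifted (τ a s) n)
      ≈⟨ +-congˡ (collect n) ⟩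
    τ a s n + n · τ a s n ∎
    where
    split : shifted s ∘ suc ≋ s ⊕ 1# ∙ shifted (s ∘ suc)
    split zero    = +-congˡ (sym (*-identityˡ _))
    split (suc k) = +-congˡ (sym (*-identityˡ _))
    collect : ∀ n → shifted (τ a (s ∘ suc)) n + a * shifted (τ a s) n ≈ n · τ a s n
    collect zero    = trans (+-identityˡ _) (zeroʳ a)
    collect (suc n) = trans (+-congˡ (×-comm-* (suc n) a _)) (sym (×-distrib-+ _ _ (suc n)))

  -- The generating function says s(f(w + a₁)) + s(f(w + a₂)) = 2 f(x); the claim is this relation
  -- for f′.
  shifted-functional : ∀ (s : Series) a₁ a₂ x →
    egf s ⊛ (exp a₁ ⊕ exp a₂) ≋ (2 · 1#) ∙ exp x →
    τ a₁ (shifted s) ⊕ τ a₂ (shifted s) ≋ shifted (x ^_) ⊕ shifted (x ^_)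
  shifted-functional s a₁ a₂ x gf zero    = refl
  shifted-functional s a₁ a₂ x gf (suc n) = begin
    τ a₁ (shifted s) (suc n) + τ a₂ (shifted s) (suc n)
      ≈⟨ +-cong (τ-shifted a₁ s (suc n)) (τ-shifted a₂ s (suc n)) ⟩
    suc n · τ a₁ s n + suc n · τ a₂ s n     ≈⟨ ×-distrib-+ _ _ (suc n) ⟨
    suc n · (τ a₁ s n + τ a₂ s n)           ≈⟨ ×-congʳ (suc n) values ⟩
    suc n · (x ^ n + x ^ n)                 ≈⟨ ×-distrib-+ _ _ (suc n) ⟩
    suc n · x ^ n + suc n · x ^ n           ∎
    where
    values : τ a₁ s n + τ a₂ s n ≈ x ^ n + x ^ n
    values = begin
      τ a₁ s n + τ a₂ s n
        ≈⟨ +-cong (egf-⊛-exp a₁ n s) (egf-⊛-exp a₂ n s) ⟨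
      (n !) · (egf s ⊛ exp a₁) n + (n !) · (egf s ⊛ exp a₂) n
        ≈⟨ ×-distrib-+ _ _ (n !) ⟨
      (n !) · ((egf s ⊛ exp a₁) n + (egf s ⊛ exp a₂) n)
        ≈⟨ ×-congʳ (n !) (trans (sym (⊛-distribˡ (egf s) (exp a₁) (exp a₂) n)) (gf n)) ⟩
      (n !) · (2 · 1# * exp x n)
        ≈⟨ ×-congʳ (n !) (sym (*-assoc (2 · 1#) (x ^ n) _)) ⟩
      (n !) · (2 · 1# * x ^ n * ι (1/ n !))
        ≈⟨ k!·[a/k!] n _ ⟩
      2 · 1# * x ^ n
        ≈⟨ ×-assoc-* 2 1# _ ⟩
      2 · (1# * x ^ n)
        ≈⟨ +-cong (*-identityˡ _) (trans (+-identityʳ _) (*-identityˡ _)) ⟩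
      x ^ n + x ^ n ∎

-- Closed form of the product over the blocks.

module Evaluation {c ℓ} (A : ℚ-Algebra c ℓ) (b d x : ℚ-Algebra.Carrier A) where
  open ℚ-Algebra A hiding (zero)
  open Over A
  open Functional A b d x
  open AntidiagonalBlocks A using (-∏_²)
  open Solver A using (solve; _:=_; _:*_; :-_; _:^_)
  open SemiringMult semiring using (×1-homo-*; ×-assoc-*; ×-congˡ; ×-congʳ)
  open Exp commutativeSemiring using (^-distrib-*; ^-homo-*; ^-assocʳ; ^-congˡ; ^-congʳ)
  open SetoidReasoning setoid

  1^n≈1 : ∀ n → 1# ^ n ≈ 1#
  1^n≈1 zero    = refl
  1^n≈1 (suc n) = trans (*-identityˡ _) (1^n≈1 n)

  ·1-homo-^ : ∀ n k → (n ℕ.^ k) · 1# ≈ (n · 1#) ^ k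
  ·1-homo-^ n zero    = +-identityʳ 1#
  ·1-homo-^ n (suc k) = trans (×1-homo-* n (n ℕ.^ k)) (*-congˡ (·1-homo-^ n k))

  W : ℕ → Carrier
  W n = (n !) · 1# * d ^ n

  W-suc : ∀ n → W (suc n) ≈ suc n · d * W n
  W-suc n = begin
    (suc n ℕ.* (n !)) · 1# * (d * d ^ n)      ≈⟨ *-congʳ (×1-homo-* (suc n) (n !)) ⟩
    suc n · 1# * (n !) · 1# * (d * d ^ n)
      ≈⟨ solve 4 (λ a f d e → a :* f :* (d :* e) := a :* d :* (f :* e))
           refl (suc n · 1#) ((n !) · 1#) d (d ^ n) ⟩
    suc n · 1# * d * W n
      ≈⟨ *-congʳ (trans (×-assoc-* (suc n) 1# d) (×-congʳ (suc n) (*-identityˡ d))) ⟩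
    suc n · d * W n ∎

  -- V_n = (-1)^n (W n)^2, and squaring removes the sign.
  V² : ∀ n → V n * V n ≈ W n ^ 4
  V² zero = begin
    1# * 1#
      ≈⟨ trans (*-identityˡ _) (sym (1^n≈1 4)) ⟩
    1# ^ 4    ≈⟨ ^-congˡ 4 (trans (*-identityʳ _) (+-identityʳ 1#)) ⟨
    W 0 ^ 4   ∎
  V² (suc n) = begin
    (- (K * K)) * V n * ((- (K * K)) * V n)
      ≈⟨ solve 2 (λ K v → (:- (K :* K)) :* v :* ((:- (K :* K)) :* v) := K :^ 4 :* (v :* v))
           refl K (V n) ⟩
    K ^ 4 * (V n * V n)                      ≈⟨ *-congˡ (V² n) ⟩
    K ^ 4 * W n ^ 4                          ≈⟨ ^-distrib-* K (W n) 4 ⟨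
    (K * W n) ^ 4                            ≈⟨ ^-congˡ 4 (W-suc n) ⟨
    W (suc n) ^ 4                            ∎
    where
    K = suc n · d

  -∏-snoc : ∀ h m → -∏_² h (suc m) ≈ -∏_² h m * (- (h m * h m))
  -∏-snoc h zero    = *-comm _ _
  -∏-snoc h (suc m) = trans (*-congˡ (-∏-snoc (h ∘ suc) m)) (sym (*-assoc _ _ _))

  -- The m + 1 factors are -(n! d^n)^8 for 0 ≤ n ≤ m, and 8 (0 + 1 + ... + m) = 4 m (m + 1).
  product-V : ∀ m → -∏_² (λ n → V n * V n) (suc m) ≈
              (- 1#) ^ suc m * (d ^ (4 ℕ.* m ℕ.* suc m) * (∏ℓ!⁸ m · 1#))
  product-V zero = begin
    (- ((1# * 1#) * (1# * 1#))) * 1#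
      ≈⟨ trans (*-identityʳ _) (-‿cong (trans (*-cong (*-identityˡ _) (*-identityˡ _)) (*-identityˡ _))) ⟩
    - 1#                                ≈⟨ *-identityʳ _ ⟨
    - 1# * 1#                           ≈⟨ *-identityʳ _ ⟨
    - 1# * 1# * 1#                      ≈⟨ *-congˡ (trans (*-identityˡ _) (+-identityʳ 1#)) ⟨
    - 1# * 1# * (1# * 1 · 1#)           ∎
  product-V (suc m) = begin
    -∏_² h (suc (suc m))                    ≈⟨ -∏-snoc h (suc m) ⟩
    -∏_² h (suc m) * (- (h (suc m) * h (suc m)))
      ≈⟨ *-cong (product-V m) (-‿cong
           (trans (*-cong (V² (suc m)) (V² (suc m))) (sym (^-homo-* (W (suc m)) 4 4)))) ⟩
    s * (e * p) * (- (W (suc m) ^ 8))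
      ≈⟨ *-congˡ (-‿cong (^-distrib-* ((suc m !) · 1#) (d ^ suc m) 8)) ⟩
    s * (e * p) * (- (f * (d ^ suc m) ^ 8)) ≈⟨ *-congˡ (-‿cong (*-congˡ (^-assocʳ d (suc m) 8))) ⟩
    s * (e * p) * (- (f * d ^ (suc m ℕ.* 8)))
      ≈⟨ solve 5 (λ s e p f g → s :* (e :* p) :* (:- (f :* g)) := (:- s) :* ((e :* g) :* (p :* f)))
           refl s e p f _ ⟩
    (- s) * ((e * d ^ (suc m ℕ.* 8)) * (p * f))
      ≈⟨ *-congʳ (-1*x≈-x s) ⟨
    - 1# * s * ((e * d ^ (suc m ℕ.* 8)) * (p * f))
      ≈⟨ *-congˡ (*-cong (trans (sym (^-homo-* d (4 ℕ.* m ℕ.* suc m) (suc m ℕ.* 8)))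
           (^-congʳ d (exponents m)))
           (trans (*-congˡ (sym (·1-homo-^ (suc m !) 8)))
           (trans (sym (×1-homo-* (∏ℓ!⁸ m) ((suc m !) ℕ.^ 8))) (×-congˡ (≡.sym (∏ℓ!⁸-suc m)))))) ⟩
    - 1# * s * (d ^ (4 ℕ.* suc m ℕ.* suc (suc m)) * (∏ℓ!⁸ (suc m) · 1#)) ∎
    where
    h : ℕ → Carrier
    h n = V n * V n
    s = (- 1#) ^ suc m
    e = d ^ (4 ℕ.* m ℕ.* suc m)
    p = ∏ℓ!⁸ m · 1#
    f = ((suc m !) · 1#) ^ 8
    open RingProperties ring using (-1*x≈-x)
    exponents : ∀ m → 4 ℕ.* m ℕ.* suc m ℕ.+ suc m ℕ.* 8 ≡ 4 ℕ.* suc m ℕ.* suc (suc m)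
    exponents = ℕ-Solver.solve-∀

-- The two Euler sequences.

module _ {c ℓ} (A : ℚ-Algebra c ℓ) where
  open ℚ-Algebra A hiding (zero)
  open Over A
  open Translation A
  open BinomialConvolution A
  open SemiringMult semiring using (×1-homo-*)

  -- The denominator e^t + 1 is e^(1t) + e^(0t), so the translations are by 0 and 1.
  FunctionalEq-eulerPolynomial : ∀ x → Functional.FunctionalEq A 0# 1# x
    (shifted (eulerPolynomial x)) (shifted (eulerPolynomial x)) (shifted (x ^_) ⊕ shifted (x ^_))
  FunctionalEq-eulerPolynomial x n = trans
    (+-congˡ (τ-cong (+-identityˡ 1#) (λ _ → refl) n)) (trans (+-comm _ _)
    (shifted-functional (eulerPolynomial x) 1# 0# x (λ n → trans
      (⊛-cong (egf (eulerPolynomial x)) _ (exp 1# ⊕ exp 0#) (exp 1# ⊕ const 1#) (λ _ → refl)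
        (λ k → +-congˡ (sym (trans (const≋exp0 1# k) (*-identityˡ _)))) n)
      (GeneratingFunctions.eulerPolynomial-gf A x n)) n))

  -- The denominator e^t + e^(-t) gives translations by -1 and 1, hence d = 2; the numerator 2 is 2
  -- e^(0t), hence x = 0.
  FunctionalEq-eulerNumber : Functional.FunctionalEq A (- 1#) (2 · 1#) 0#
    (shifted eulerNumber) (shifted eulerNumber) (shifted (0# ^_) ⊕ shifted (0# ^_))
  FunctionalEq-eulerNumber n = trans (+-congˡ (τ-cong -1+2≈1 (λ _ → refl) n)) (trans (+-comm _ _)
    (shifted-functional eulerNumber 1# (- 1#) 0# (λ n → trans
      (GeneratingFunctions.eulerNumber-gf A n) (const≋exp0 (2 · 1#) n)) n))
    where
    -1+2≈1 : - 1# + 2 · 1# ≈ 1#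
    -1+2≈1 = trans (sym (+-assoc _ _ _))
      (trans (+-cong (-‿inverseˡ 1#) (+-identityʳ 1#)) (+-identityˡ 1#))

  hankel-eulerPolynomial₂ₘ : ∀ x m → H (2 ℕ.* m) (shifted (eulerPolynomial x)) ≈ 0#
  hankel-eulerPolynomial₂ₘ x m =
    Hankel.H₂ₘ≈0 A 0# 1# x (shifted (eulerPolynomial x)) (FunctionalEq-eulerPolynomial x) m

  hankel-eulerPolynomial₂ₘ₊₁ : ∀ x m →
    H (suc (2 ℕ.* m)) (shifted (eulerPolynomial x)) ≈ (- 1#) ^ suc m * (∏ℓ!⁸ m · 1#)
  hankel-eulerPolynomial₂ₘ₊₁ x m = trans
    (Hankel.H₂ₘ₊₁ A 0# 1# x (shifted (eulerPolynomial x)) (FunctionalEq-eulerPolynomial x) m)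
    (trans (Evaluation.product-V A 0# 1# x m)
      (*-congˡ (trans (*-congʳ (Evaluation.1^n≈1 A 0# 1# x (4 ℕ.* m ℕ.* suc m))) (*-identityˡ _))))

  hankel-eulerNumber₂ₘ : ∀ m → H (2 ℕ.* m) (shifted eulerNumber) ≈ 0#
  hankel-eulerNumber₂ₘ m =
    Hankel.H₂ₘ≈0 A (- 1#) (2 · 1#) 0# (shifted eulerNumber) FunctionalEq-eulerNumber m

  hankel-eulerNumber₂ₘ₊₁ : ∀ m → H (suc (2 ℕ.* m)) (shifted eulerNumber) ≈
    (- 1#) ^ suc m * ((2 ℕ.^ (4 ℕ.* m ℕ.* suc m) ℕ.* ∏ℓ!⁸ m) · 1#)
  hankel-eulerNumber₂ₘ₊₁ m = trans
    (Hankel.H₂ₘ₊₁ A (- 1#) (2 · 1#) 0# (shifted eulerNumber) FunctionalEq-eulerNumber m)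
    (trans (product-V m) (*-congˡ (sym (trans (×1-homo-* (2 ℕ.^ k) (∏ℓ!⁸ m)) (*-congʳ (·1-homo-^ 2 k))))))
    where
    open Evaluation A (- 1#) (2 · 1#) 0# using (product-V; ·1-homo-^)
    k = 4 ℕ.* m ℕ.* suc m

corollary3p4 : ∀ {c ℓ} (A : ℚ-Algebra c ℓ) (x : ℚ-Algebra.Carrier A) (m : ℕ) →
    let open ℚ-Algebra A
        open Over A
    in
      (H (2 ℕ.* m) (shifted (eulerPolynomial x)) ≈ 0#)
    × (Rational.H (2 ℕ.* m) (Rational.shifted Rational.eulerNumber) ≡ 0ℚ)
    × (H (suc (2 ℕ.* m)) (shifted (eulerPolynomial x))
         ≈ (- 1#) ^ suc m * (∏ℓ!⁸ m · 1#))
    × (Rational.H (suc (2 ℕ.* m)) (Rational.shifted Rational.eulerNumber)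
         ≡ (ℚ.- 1ℚ) Rational.^ suc m ℚ.* ((2 ℕ.^ (4 ℕ.* m ℕ.* suc m) ℕ.* ∏ℓ!⁸ m) Rational.· 1ℚ))
corollary3p4 A x m =
  hankel-eulerPolynomial₂ₘ A x m , hankel-eulerNumber₂ₘ ℚ-algebra m ,
  hankel-eulerPolynomial₂ₘ₊₁ A x m , hankel-eulerNumber₂ₘ₊₁ ℚ-algebra m
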